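{- Let $1\le\ell\le m$ and let $\alpha=(\alpha_1,\dots,\alpha_\ell)$ with $1\le\alpha_1<\dots<\alpha_\ell\le m$ decompose into $u+1$ consecutive blocks, i.e. there are $1\le p_1<\dots<p_u<\ell$ such that, with $p_0=0$ and $p_{u+1}=\ell$, the entries $\alpha_{p_i+1},\dots,\alpha_{p_{i+1}}$ are consecutive integers for each $0\le i\le u$. Then the length $n_\alpha$ of the Schubert code $C_\alpha(\ell,m)$ (the number of $\mathbb{F}_q$-rational points of $\Omega_\alpha$) is $$n_\alpha=\sum_{s_1=p_1}^{\alpha_{p_1}}\sum_{s_2=p_2}^{\alpha_{p_2}}\cdots\sum_{s_u=p_u}^{\alpha_{p_u}}\ \prod_{i=0}^{u}\lambda(\alpha_{p_i},\alpha_{p_{i+1}};s_i,s_{i+1}),$$ with the conventions $s_0=p_0=0$, $s_{u+1}=p_{u+1}=\ell$, and $\alpha_0=0$.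
   Context: $\mathbb{F}_q$ is the finite field with $q$ elements, $V=\mathbb{F}_q^m$ with standard basis $e_1,\dots,e_m$, $A_j=\mathrm{span}(e_1,\dots,e_j)$ ($A_0=0$). $G_{\ell,m}$ is the Grassmannian of $\ell$-dimensional subspaces of $V$, and $\Omega_\alpha=\{W\in G_{\ell,m}:\dim(W\cap A_{\alpha_i})\ge i,\ i=1,\dots,\ell\}$. The Schubert code $C_\alpha(\ell,m)$ is the linear code associated with the projective system of $\mathbb{F}_q$-rational points of $\Omega_\alpha$ under the Plücker embedding into $\mathbb{P}(\wedge^\ell V)$ (inside the linear span of their images); its length is the number of these points. Gaussian binomial: ${u\brack v}_q=\prod_{i=0}^{v-1}\frac{q^u-q^i}{q^v-q^i}$ if $0\le v\le u$, and $0$ otherwise. For integers $a,b,s,t$, $\lambda(a,b;s,t)=\sum_{r=s}^{t}(-1)^{r-s}q^{\binom{r-s}{2}}{a-s\brack r-s}_q{b-r\brack t-r}_q$. -}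

module Defs where

open import Data.Nat as ℕ using (ℕ; zero; suc; _∸_; _^_; _≤_; _<_)
open import Data.Nat.DivMod using (_/_)
open import Data.Nat.Combinatorics using (_C_)
open import Data.Integer as ℤ using (ℤ; +_; -[1+_])
open import Data.Fin using (Fin; toℕ)
import Data.Fin as Fin
open import Data.Vec using (Vec; zipWith; map; replicate; lookup)
open import Data.Vec.Functional using (_∷_)
open import Data.List using (List; upTo; foldr)
import Data.List as List
open import Data.Bool using (Bool; true; false)
open import Data.Product using (Σ; ∃; _×_; _,_)
open import Relation.Binary.PropositionalEquality using (_≡_)
open import Relation.Nullary using (¬_)
open import Algebra.Structures using (IsCommutativeRing)

-- A finite field with q elements, realised on the carrier Fin q
-- (every finite field of order q is isomorphic to one of this form).

record FiniteField (q : ℕ) : Set where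
  field
    _+_ _*_ : Fin q → Fin q → Fin q
    -_      : Fin q → Fin q
    0# 1#   : Fin q
    isCommutativeRing : IsCommutativeRing _≡_ _+_ _*_ -_ 0# 1#
    0≢1     : ¬ (0# ≡ 1#)
    inverse : ∀ x → ¬ (x ≡ 0#) → Σ (Fin q) (λ y → (x * y) ≡ 1#)

module LinAlg {q : ℕ} (F : FiniteField q) (m : ℕ) where
  open FiniteField F

  V : Set
  V = Vec (Fin q) m

  zeroV : V
  zeroV = replicate m 0#

  _⊕_ : V → V → V
  _⊕_ = zipWith _+_

  _⊙_ : Fin q → V → V
  c ⊙ v = map (c *_) v

  Subset : Set
  Subset = V → Bool

  IsSubspace : Subset → Set
  IsSubspace W = (W zeroV ≡ true)
    × (∀ v w → W v ≡ true → W w ≡ true → W (v ⊕ w) ≡ true)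
    × (∀ c v → W v ≡ true → W (c ⊙ v) ≡ true)

  lincomb : ∀ {d} → (Fin d → Fin q) → (Fin d → V) → V
  lincomb {zero}  c b = zeroV
  lincomb {suc d} c b = (c Fin.zero ⊙ b Fin.zero) ⊕ lincomb (λ k → c (Fin.suc k)) (λ k → b (Fin.suc k))

  LinIndep : ∀ {d} → (Fin d → V) → Set
  LinIndep {d} b = ∀ (c : Fin d → Fin q) → lincomb c b ≡ zeroV → ∀ k → c k ≡ 0#

  IsBasis : ∀ {d} → Subset → (Fin d → V) → Set
  IsBasis U b = (∀ k → U (b k) ≡ true) × LinIndep b
    × (∀ v → U v ≡ true → ∃ λ c → lincomb c b ≡ v)

  HasDim : Subset → ℕ → Set
  HasDim U d = Σ (Fin d → V) (λ b → IsBasis U b)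

  DimGE : Subset → ℕ → Set
  DimGE U i = ∃ λ d → (i ≤ d) × HasDim U d

  -- A_j = span(e_1,…,e_j): vectors whose coordinates j+1,…,m vanish
  A : ℕ → Subset
  A j v = Data.Vec.foldr _ Data.Bool._∧_ true
            (Data.Vec.tabulate (λ (k : Fin m) → isZeroOrLow k))
    where
      isZeroOrLow : Fin m → Bool
      isZeroOrLow k with toℕ k ℕ.<? j
      ... | Relation.Nullary.yes _ = true
      ... | Relation.Nullary.no _ with lookup v k Fin.≟ 0#
      ...   | Relation.Nullary.yes _ = true
      ...   | Relation.Nullary.no _  = false

  _∩_ : Subset → Subset → Subset
  (U ∩ W) v = U v Data.Bool.∧ W v

  -- W ∈ Ω_α ⊆ G_{ℓ,m}, with α given 1-indexed as α (i) = α_{i+1}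
  InSchubert : (ℓ : ℕ) → (Fin ℓ → ℕ) → Subset → Set
  InSchubert ℓ α W = IsSubspace W × HasDim W ℓ
    × (∀ (i : Fin ℓ) → DimGE (W ∩ A (α i)) (suc (toℕ i)))

  _≈S_ : Subset → Subset → Set
  U ≈S W = ∀ v → U v ≡ W v

  HasCount : (Subset → Set) → ℕ → Set
  HasCount P N = Σ (Fin N → Subset) λ e →
      (∀ i → P (e i))
    × (∀ i j → e i ≈S e j → i ≡ j)
    × (∀ W → P W → ∃ λ i → W ≈S e i)

-- division returning 0 for divisor 0 (never used with divisor 0 when q ≥ 2)
_div_ : ℕ → ℕ → ℕ
a div zero = 0
a div suc b = a / suc b

prodUpTo : ℕ → (ℕ → ℕ) → ℕ
prodUpTo n f = foldr (λ i acc → f i ℕ.* acc) 1 (upTo n)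

gaussℕ : ℕ → ℕ → ℕ → ℕ
gaussℕ q u v with v ℕ.≤? u
... | Relation.Nullary.yes _ =
      prodUpTo v (λ i → q ^ u ∸ q ^ i) div prodUpTo v (λ i → q ^ v ∸ q ^ i)
... | Relation.Nullary.no _ = 0

gauss : ℕ → ℤ → ℤ → ℤ
gauss q (+ u) (+ v) = + gaussℕ q u v
gauss q _ _ = + 0

-- Σ_{r=s}^{t} f r  (empty if t < s)
sumFromTo : ℕ → ℕ → (ℕ → ℤ) → ℤ
sumFromTo s t f = foldr (λ k acc → f (s ℕ.+ k) ℤ.+ acc) (+ 0) (upTo (suc t ∸ s))

sign : ℕ → ℤ
sign k with k ℕ.% 2
... | zero = + 1
... | suc _ = ℤ.- (+ 1)

lam : ℕ → ℕ → ℕ → ℕ → ℕ → ℤ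
lam q a b s t = sumFromTo s t λ r →
  sign (r ∸ s) ℤ.* (+ (q ^ ((r ∸ s) C 2)))
    ℤ.* gauss q (+ a ℤ.- + s) (+ r ℤ.- + s)
    ℤ.* gauss q (+ b ℤ.- + r) (+ t ℤ.- + r)

boxSum : ∀ {u} → (Fin u → ℕ) → (Fin u → ℕ) → ((Fin u → ℕ) → ℤ) → ℤ
boxSum {zero} lo hi f = f (λ ())
boxSum {suc u} lo hi f = sumFromTo (lo Fin.zero) (hi Fin.zero) λ x →
  boxSum (λ k → lo (Fin.suc k)) (λ k → hi (Fin.suc k)) (λ s → f (x ∷ s))

prodFin : ∀ {n} → (Fin n → ℤ) → ℤ
prodFin {zero} f = + 1
prodFin {suc n} f = f Fin.zero ℤ.* prodFin (λ k → f (Fin.suc k))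

-- extend a sequence x_1,…,x_u (given 0-indexed as x : Fin u → ℕ)
-- to x_0 = 0, x_1,…,x_u, x_{u+1} = top, indexed by ℕ
extend : ∀ {u} → (Fin u → ℕ) → ℕ → ℕ → ℕ
extend x top zero = 0
extend {u} x top (suc k) with k ℕ.<? u
... | Relation.Nullary.yes k<u = x (Fin.fromℕ< k<u)
... | Relation.Nullary.no _ = top

-- α_0 = 0, α_1,…,α_ℓ (α given 0-indexed), α_j := 0 for j > ℓ (unused)
αAt : ∀ {ℓ} → (Fin ℓ → ℕ) → ℕ → ℕ
αAt α j = extend α 0 j

StrictIncr : ∀ {n} → (Fin n → ℕ) → Set
StrictIncr {n} x = ∀ (i j : Fin n) → toℕ i < toℕ j → x i < x j

Blocks : (ℓ : ℕ) → (Fin ℓ → ℕ) → (u : ℕ) → (Fin u → ℕ) → Set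
Blocks ℓ α u p =
    StrictIncr p
  × (∀ (k : Fin u) → 1 ≤ p k × p k < ℓ)
  × (∀ (i : ℕ) → i ≤ u → ∀ (j : ℕ) →
       suc (extend p ℓ i) ≤ j → j < extend p ℓ (suc i) →
       αAt α (suc j) ≡ suc (αAt α j))

schubertLength : (q ℓ : ℕ) → (Fin ℓ → ℕ) → (u : ℕ) → (Fin u → ℕ) → ℤ
schubertLength q ℓ α u p =
  boxSum (λ k → p k) (λ k → αAt α (p k)) λ s →
    prodFin {suc u} λ i →
      lam q (αAt α (extend p ℓ (toℕ i)))
            (αAt α (extend p ℓ (suc (toℕ i))))
            (extend s ℓ (toℕ i))
            (extend s ℓ (suc (toℕ i)))

{-# OPTIONS --safe #-}
-- Reduce every W ⊆ F_q^m to an echelon form by treating the coordinates one at a time: projected along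
-- e_1, W becomes a subspace of F_q^(m-1), and W is either the preimage of that subspace or the graph
-- of a linear functional on it. The jumps of the form in the first j coordinates are dim (W ∩ A_j), and since
-- dim (W ∩ A_j) grows by at most 1 with j, only the conditions at the ends of the blocks matter.
-- Counting forms gives a recursion along the walk j ↦ dim (W ∩ A_j). Summed over a block from
-- a to b with dimensions s and t it yields q^((a-s)(t-s)) [b-a choose t-s], and this is
-- λ(a,b;s,t): by q-Pascal the alternating sum is multiplied by q^(t-s) when a and b grow by 1.
module Submission where

open import Defs
open import Data.Nat using (ℕ; _≤_; _<_)
open import Data.Fin using (Fin)
open import Data.Integer using (+_)
open import Data.Product using (_×_)
open import Relation.Binary.PropositionalEquality using (_≡_)

open import Data.Nat as ℕ using (zero; suc; _∸_; _^_; z≤n; s≤s; NonZero)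
import Data.Nat.Properties as ℕₚ
open import Data.Nat.DivMod using (m*n/n≡m)
open import Data.Nat.Combinatorics using (_C_; nCk+nC[k+1]≡[n+1]C[k+1]; nC1≡n)
import Data.Nat.Tactic.RingSolver as ℕ-Solver
open import Data.Integer as ℤ using (ℤ)
import Data.Integer.Properties as ℤₚ
import Data.Integer.Tactic.RingSolver as ℤ-Solver
open import Data.Bool as Bool using (Bool; true; false; _∧_; if_then_else_)
open import Data.Fin as Fin using (toℕ; finToFun; funToFin)
import Data.Fin.Properties as Finₚ
open import Data.Vec as Vec using (Vec; []; _∷_; lookup; tabulate)
import Data.Vec.Properties as Vecₚ
import Data.Vec.Functional as Functional
open import Data.List as List using (List; length; allFin; applyUpTo; cartesianProductWith; foldr)
import Data.List.Properties as Listₚ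
open import Data.List.Membership.Propositional using (_∈_)
import Data.List.Membership.Propositional.Properties as ∈ₚ
open import Data.List.Relation.Unary.Any using (here; index)
import Data.List.Relation.Unary.Any.Properties as Anyₚ
import Data.List.Relation.Unary.All as All
open import Data.List.Relation.Unary.AllPairs using ([]; _∷_)
open import Data.List.Relation.Unary.Unique.Propositional using (Unique)
import Data.List.Relation.Unary.Unique.Propositional.Properties as Uniqueₚ
open import Data.Product using (Σ; ∃; _,_; proj₁; proj₂)
open import Data.Sum using (inj₁; inj₂)
open import Data.Empty using (⊥-elim)
open import Function using (_∘_; id)
open import Relation.Nullary using (¬_; Dec; yes; no; _×-dec_; _→-dec_)
open import Relation.Nullary.Decidable using (⌊_⌋)
open import Relation.Binary.PropositionalEquality using
  (refl; sym; trans; cong; cong₂; subst; subst₂; module ≡-Reasoning)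
open import Algebra.Bundles using (CommutativeRing)
import Algebra.Properties.Ring
import Algebra.Properties.CommutativeSemigroup

-- Finite products and sums

-- λ is a Möbius inversion: for a fixed s-dimensional S in A_a it counts the t-dimensional T in A_b
-- with T ∩ A_a = S, and (-1)^(r-s) q^binom(r-s,2) is the Möbius function of the subspace lattice.
-- Such a T is also given by its image in A_b/A_a, of dimension t-s, together with a linear map from
-- this image to A_a/S. This is the origin of q^((a-s)(t-s)) [b-a choose t-s], which is free of
-- signs and therefore suited to a recursion that counts. An echelon form has one free coefficient
-- for each pair of a skip and a later jump. The list of forms charges the pair to the skip, where
-- the exponent depends on the jumps still to come; the walk charges it to the jump, where the
-- exponent a-s is already known, so that the weights inside a block do not depend on what follows.
-- The box of the theorem contains unreachable dimensions. For a step from s to an unreachable t the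
-- factor λ is 0, so they do no harm.

∏ : ℕ → (ℕ → ℕ) → ℕ
∏ zero    f = 1
∏ (suc n) f = f 0 ℕ.* ∏ n (f ∘ suc)

foldr-applyUpTo-∏ : ∀ n (f g : ℕ → ℕ) →
  foldr (λ i acc → f i ℕ.* acc) 1 (applyUpTo g n) ≡ ∏ n (f ∘ g)
foldr-applyUpTo-∏ zero    f g = refl
foldr-applyUpTo-∏ (suc n) f g = cong (f (g 0) ℕ.*_) (foldr-applyUpTo-∏ n f (g ∘ suc))

∏-cong : ∀ n {f g : ℕ → ℕ} → (∀ i → f i ≡ g i) → ∏ n f ≡ ∏ n g
∏-cong zero    e = refl
∏-cong (suc n) e = cong₂ ℕ._*_ (e 0) (∏-cong n (e ∘ suc))

∏-last : ∀ n f → ∏ (suc n) f ≡ ∏ n f ℕ.* f n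
∏-last zero    f = ℕₚ.*-comm (f 0) 1
∏-last (suc n) f = trans (cong (f 0 ℕ.*_) (∏-last n (f ∘ suc))) (sym (ℕₚ.*-assoc (f 0) _ _))

∏-scale : ∀ c n f → ∏ n (λ i → c ℕ.* f i) ≡ c ^ n ℕ.* ∏ n f
∏-scale c zero    f = refl
∏-scale c (suc n) f rewrite ∏-scale c n (f ∘ suc) = shuffle c (f 0) (c ^ n) (∏ n (f ∘ suc))
  where
  shuffle : ∀ a b x y → (a ℕ.* b) ℕ.* (x ℕ.* y) ≡ (a ℕ.* x) ℕ.* (b ℕ.* y)
  shuffle = ℕ-Solver.solve-∀

∏-pos : ∀ n f → (∀ i → i < n → 0 < f i) → 0 < ∏ n f
∏-pos zero    f pos = ℕₚ.≤-refl
∏-pos (suc n) f pos = ℕₚ.*-mono-≤ (pos 0 (s≤s z≤n)) (∏-pos n (f ∘ suc) (λ i i<n → pos (suc i) (s≤s i<n)))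

∏-zero : ∀ n f i → i < n → f i ≡ 0 → ∏ n f ≡ 0
∏-zero (suc n) f zero    _         e rewrite e = refl
∏-zero (suc n) f (suc i) (s≤s i<n) e rewrite ∏-zero n (f ∘ suc) i i<n e = ℕₚ.*-zeroʳ (f 0)

∑ : ℕ → (ℕ → ℤ) → ℤ
∑ zero    f = + 0
∑ (suc n) f = f 0 ℤ.+ ∑ n (f ∘ suc)

foldr-applyUpTo-∑ : ∀ n (f : ℕ → ℤ) (g : ℕ → ℕ) →
  foldr (λ i acc → f i ℤ.+ acc) (+ 0) (applyUpTo g n) ≡ ∑ n (f ∘ g)
foldr-applyUpTo-∑ zero    f g = refl
foldr-applyUpTo-∑ (suc n) f g = cong (ℤ._+_ (f (g 0))) (foldr-applyUpTo-∑ n f (g ∘ suc))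

∑-cong : ∀ n {f g : ℕ → ℤ} → (∀ i → i < n → f i ≡ g i) → ∑ n f ≡ ∑ n g
∑-cong zero    e = refl
∑-cong (suc n) e = cong₂ ℤ._+_ (e 0 (s≤s z≤n)) (∑-cong n (λ i i<n → e (suc i) (s≤s i<n)))

∑-last : ∀ n f → ∑ (suc n) f ≡ ∑ n f ℤ.+ f n
∑-last zero    f = ℤₚ.+-comm (f 0) (+ 0)
∑-last (suc n) f = trans (cong (ℤ._+_ (f 0)) (∑-last n (f ∘ suc))) (sym (ℤₚ.+-assoc (f 0) _ _))

∑-+ : ∀ n f g → ∑ n (λ i → f i ℤ.+ g i) ≡ ∑ n f ℤ.+ ∑ n g
∑-+ zero    f g = refl
∑-+ (suc n) f g rewrite ∑-+ n (f ∘ suc) (g ∘ suc) = shuffle (f 0) (g 0) (∑ n (f ∘ suc)) (∑ n (g ∘ suc))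
  where
  shuffle : ∀ a b x y → (a ℤ.+ b) ℤ.+ (x ℤ.+ y) ≡ (a ℤ.+ x) ℤ.+ (b ℤ.+ y)
  shuffle = ℤ-Solver.solve-∀

∑-scale : ∀ c n f → ∑ n (λ i → c ℤ.* f i) ≡ c ℤ.* ∑ n f
∑-scale c zero    f = sym (ℤₚ.*-zeroʳ c)
∑-scale c (suc n) f rewrite ∑-scale c n (f ∘ suc) = sym (ℤₚ.*-distribˡ-+ c _ _)

∑-zero : ∀ n f → (∀ i → i < n → f i ≡ + 0) → ∑ n f ≡ + 0
∑-zero zero    f e = refl
∑-zero (suc n) f e rewrite e 0 (s≤s z≤n) | ∑-zero n (f ∘ suc) (λ i i<n → e (suc i) (s≤s i<n)) = refl

∑-drop : ∀ p n f → (∀ i → i < p → f i ≡ + 0) → ∑ n f ≡ ∑ (n ∸ p) (λ k → f (p ℕ.+ k))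
∑-drop zero    n       f e = refl
∑-drop (suc p) zero    f e = refl
∑-drop (suc p) (suc n) f e rewrite e 0 (s≤s z≤n) =
  trans (ℤₚ.+-identityˡ _) (∑-drop p n (f ∘ suc) (λ i i<p → e (suc i) (s≤s i<p)))

∑-extend : ∀ n k f → (∀ i → n ≤ i → i < n ℕ.+ k → f i ≡ + 0) → ∑ (n ℕ.+ k) f ≡ ∑ n f
∑-extend zero    k f e = ∑-zero k f (λ i → e i z≤n)
∑-extend (suc n) k f e = cong (ℤ._+_ (f 0)) (∑-extend n k (f ∘ suc) (λ i n≤i i<nk → e (suc i) (s≤s n≤i) (s≤s i<nk)))

sumFromTo≡∑ : ∀ s t f → sumFromTo s t f ≡ ∑ (suc t ∸ s) (λ k → f (s ℕ.+ k))
sumFromTo≡∑ s t f = foldr-applyUpTo-∑ (suc t ∸ s) (λ k → f (s ℕ.+ k)) id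

sumFromTo-empty : ∀ s t f → t < s → sumFromTo s t f ≡ + 0
sumFromTo-empty s t f t<s rewrite ℕₚ.m≤n⇒m∸n≡0 t<s = refl

-- Gaussian binomials

module Gaussian (q : ℕ) where

  -- The q-Pascal rule serves as the definition: it needs no division, and `shiftG-pascal`,
  -- `term-suc` and `kernel-suc` all unfold it.
  G : ℕ → ℕ → ℕ
  G _       zero    = 1
  G zero    (suc v) = 0
  G (suc u) (suc v) = q ^ suc v ℕ.* G u (suc v) ℕ.+ G u v

  G-vanish : ∀ u v → u < v → G u v ≡ 0
  G-vanish zero    (suc v) _ = refl
  G-vanish (suc u) (suc v) (s≤s u<v)
    rewrite G-vanish u (suc v) (ℕₚ.m<n⇒m<1+n u<v) | G-vanish u v u<v | ℕₚ.*-zeroʳ (q ^ suc v) = refl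

  -- The number of ordered linearly independent v-tuples in F_q^u: numerator and denominator of the
  -- Gaussian binomial.
  falling : ℕ → ℕ → ℕ
  falling u v = ∏ v (λ i → q ^ u ∸ q ^ i)

  falling-suc : ∀ u v → falling (suc u) (suc v) ≡ (q ^ suc u ∸ 1) ℕ.* (q ^ v ℕ.* falling u v)
  falling-suc u v = cong ((q ^ suc u ∸ 1) ℕ.*_)
    (trans (∏-cong v (λ i → sym (ℕₚ.*-distribˡ-∸ q (q ^ u) (q ^ i)))) (∏-scale q v _))

  falling-vanish : ∀ u v → u < v → falling u v ≡ 0
  falling-vanish u v u<v = ∏-zero v _ u u<v (ℕₚ.n∸n≡0 (q ^ u))

module GaussianQuotient (q : ℕ) (2≤q : 2 ≤ q) where
  open Gaussian q

  instance
    q-nonZero : NonZero q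
    q-nonZero = ℕ.>-nonZero (ℕₚ.<-trans (s≤s z≤n) 2≤q)

  falling-pos : ∀ v → 0 < falling v v
  falling-pos v = ∏-pos v _ (λ i i<v → ℕₚ.m<n⇒0<n∸m (ℕₚ.^-monoʳ-< q 2≤q i<v))

  -- The quotient formula with its denominator cleared, so that the induction stays free of
  -- division.
  G-falling : ∀ u v → G u v ℕ.* falling v v ≡ falling u v
  G-falling u       zero    = refl
  G-falling zero    (suc v) = sym (falling-vanish 0 (suc v) (s≤s z≤n))
  G-falling (suc u) (suc v) with ℕₚ.≤-<-connex v u
  ... | inj₂ u<v rewrite G-vanish (suc u) (suc v) (s≤s u<v) | falling-vanish (suc u) (suc v) (s≤s u<v) = refl
  ... | inj₁ v≤u = begin
    (q ^ suc v ℕ.* G u (suc v) ℕ.+ G u v) ℕ.* falling (suc v) (suc v)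
      ≡⟨ distrib (q ^ suc v) (G u (suc v)) (G u v) _ ⟩
    q ^ suc v ℕ.* (G u (suc v) ℕ.* falling (suc v) (suc v)) ℕ.+ G u v ℕ.* falling (suc v) (suc v)
      -- One product gives up its last factor X, the other its first factor Y. Once q^v times
      -- `falling u v` is taken out, q X + Y remains.
      ≡⟨ cong₂ (λ x y → q ^ suc v ℕ.* x ℕ.+ G u v ℕ.* y)
           (trans (G-falling u (suc v)) (∏-last v (λ i → q ^ u ∸ q ^ i))) (falling-suc v v) ⟩
    q ^ suc v ℕ.* (falling u v ℕ.* X) ℕ.+ G u v ℕ.* (Y ℕ.* (q ^ v ℕ.* falling v v))
      ≡⟨ regroup q (q ^ v) (falling u v) X (G u v) Y (falling v v) ⟩
    q ^ v ℕ.* (falling u v ℕ.* (q ℕ.* X) ℕ.+ (G u v ℕ.* falling v v) ℕ.* Y)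
      ≡⟨ cong (λ z → q ^ v ℕ.* (falling u v ℕ.* (q ℕ.* X) ℕ.+ z ℕ.* Y)) (G-falling u v) ⟩
    q ^ v ℕ.* (falling u v ℕ.* (q ℕ.* X) ℕ.+ falling u v ℕ.* Y)
      ≡⟨ collect (q ^ v) (falling u v) (q ℕ.* X) Y ⟩
    (q ℕ.* X ℕ.+ Y) ℕ.* (q ^ v ℕ.* falling u v)
      ≡⟨ cong (ℕ._* (q ^ v ℕ.* falling u v)) telescope ⟩
    (q ^ suc u ∸ 1) ℕ.* (q ^ v ℕ.* falling u v)
      ≡⟨ falling-suc u v ⟨
    falling (suc u) (suc v) ∎
    where
    open ≡-Reasoning
    X Y : ℕ
    X = q ^ u ∸ q ^ v
    Y = q ^ suc v ∸ 1
    distrib : ∀ a b c d → (a ℕ.* b ℕ.+ c) ℕ.* d ≡ a ℕ.* (b ℕ.* d) ℕ.+ c ℕ.* d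
    distrib = ℕ-Solver.solve-∀
    regroup : ∀ q a f x g y d →
      (q ℕ.* a) ℕ.* (f ℕ.* x) ℕ.+ g ℕ.* (y ℕ.* (a ℕ.* d)) ≡ a ℕ.* (f ℕ.* (q ℕ.* x) ℕ.+ (g ℕ.* d) ℕ.* y)
    regroup = ℕ-Solver.solve-∀
    collect : ∀ a f x y → a ℕ.* (f ℕ.* x ℕ.+ f ℕ.* y) ≡ (x ℕ.+ y) ℕ.* (a ℕ.* f)
    collect = ℕ-Solver.solve-∀
    -- Here v ≤ u matters: only then do the truncated differences cancel.
    telescope : q ℕ.* X ℕ.+ Y ≡ q ^ suc u ∸ 1
    telescope = begin
      q ℕ.* X ℕ.+ Y                       ≡⟨ cong (ℕ._+ Y) (ℕₚ.*-distribˡ-∸ q (q ^ u) (q ^ v)) ⟩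
      (q ^ suc u ∸ q ^ suc v) ℕ.+ Y       ≡⟨ ℕₚ.+-∸-assoc (q ^ suc u ∸ q ^ suc v) (ℕₚ.m^n>0 q (suc v)) ⟨
      ((q ^ suc u ∸ q ^ suc v) ℕ.+ q ^ suc v) ∸ 1
        ≡⟨ cong (_∸ 1) (ℕₚ.m∸n+n≡m (ℕₚ.^-monoʳ-≤ q (s≤s v≤u))) ⟩
      q ^ suc u ∸ 1 ∎

  div-unique : ∀ g d → 0 < d → (g ℕ.* d) div d ≡ g
  div-unique g (suc d) _ = m*n/n≡m g (suc d)

  gaussℕ≡G : ∀ u v → gaussℕ q u v ≡ G u v
  gaussℕ≡G u v with v ℕ.≤? u
  ... | no v≰u = sym (G-vanish u v (ℕₚ.≰⇒> v≰u))
  ... | yes _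
    rewrite foldr-applyUpTo-∏ v (λ i → q ^ u ∸ q ^ i) id
          | foldr-applyUpTo-∏ v (λ i → q ^ v ∸ q ^ i) id
          | sym (G-falling u v) = div-unique (G u v) _ (falling-pos v)

  -- The alternating sum λ in closed form

  weight : ℕ → ℤ
  weight k = sign k ℤ.* + (q ^ (k C 2))

  sign-suc : ∀ k → sign (suc k) ≡ ℤ.- sign k
  sign-suc zero          = refl
  sign-suc (suc zero)    = refl
  sign-suc (suc (suc k)) = sign-suc k

  suc-C-2 : ∀ k → suc k C 2 ≡ k ℕ.+ k C 2
  suc-C-2 k = trans (sym (nCk+nC[k+1]≡[n+1]C[k+1] k 1)) (cong (ℕ._+ k C 2) (nC1≡n k))

  weight-suc : ∀ k → weight (suc k) ≡ ℤ.- (weight k ℤ.* + (q ^ k))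
  weight-suc k = begin
    sign (suc k) ℤ.* + (q ^ (suc k C 2))
      ≡⟨ cong₂ (λ x y → x ℤ.* + (q ^ y)) (sign-suc k) (suc-C-2 k) ⟩
    (ℤ.- sign k) ℤ.* + (q ^ (k ℕ.+ k C 2))
      ≡⟨ cong (ℤ._*_ (ℤ.- sign k)) (trans (cong +_ (ℕₚ.^-distribˡ-+-* q k (k C 2))) (ℤₚ.pos-* (q ^ k) (q ^ (k C 2)))) ⟩
    (ℤ.- sign k) ℤ.* (+ (q ^ k) ℤ.* + (q ^ (k C 2)))
      ≡⟨ shuffle (sign k) (+ (q ^ k)) (+ (q ^ (k C 2))) ⟩
    ℤ.- (weight k ℤ.* + (q ^ k)) ∎
    where
    open ≡-Reasoning
    shuffle : ∀ s a b → (ℤ.- s) ℤ.* (a ℤ.* b) ≡ ℤ.- ((s ℤ.* b) ℤ.* a)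
    shuffle = ℤ-Solver.solve-∀

  -- G (N ∸ k) (T ∸ k) for k ≤ N and k ≤ T, and 0 otherwise
  shiftG : ℕ → ℕ → ℕ → ℕ
  shiftG N       T       zero    = G N T
  shiftG (suc N) (suc T) (suc k) = shiftG N T k
  shiftG zero    _       (suc k) = 0
  shiftG (suc N) zero    (suc k) = 0

  shiftG≡G : ∀ N T k → k ≤ N → k ≤ T → shiftG N T k ≡ G (N ∸ k) (T ∸ k)
  shiftG≡G N       T       zero    _         _         = refl
  shiftG≡G (suc N) (suc T) (suc k) (s≤s k≤N) (s≤s k≤T) = shiftG≡G N T k k≤N k≤T

  shiftG-vanish : ∀ N T k → T < k → shiftG N T k ≡ 0
  shiftG-vanish zero    T       (suc k) _         = refl
  shiftG-vanish (suc N) zero    (suc k) _         = refl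
  shiftG-vanish (suc N) (suc T) (suc k) (s≤s T<k) = shiftG-vanish N T k T<k

  -- At shifted arguments Pascal's rule has the coefficient q^(T+1-k). Multiplied by q^k it becomes
  -- q^(T+1), the same for all k, and can leave the sum. At k = N+1 the rule may fail, since
  -- `shiftG N` is already 0 there.
  shiftG-pascal : ∀ N T k → k ≤ N →
    q ^ k ℕ.* shiftG (suc N) (suc T) k ≡ q ^ suc T ℕ.* shiftG N (suc T) k ℕ.+ q ^ k ℕ.* shiftG N T k
  shiftG-pascal N T zero _ = cancel (q ^ suc T) (G N (suc T)) (G N T)
    where
    cancel : ∀ a x y → 1 ℕ.* (a ℕ.* x ℕ.+ y) ≡ a ℕ.* x ℕ.+ 1 ℕ.* y
    cancel = ℕ-Solver.solve-∀
  shiftG-pascal (suc N) zero    (suc zero)    _ = base q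
    where
    base : ∀ q → q ℕ.* 1 ℕ.* 1 ≡ q ℕ.* 1 ℕ.* 1 ℕ.+ q ℕ.* 1 ℕ.* 0
    base = ℕ-Solver.solve-∀
  shiftG-pascal (suc N) zero    (suc (suc k)) _
    rewrite shiftG-vanish N 0 (suc k) (s≤s z≤n) | ℕₚ.*-zeroʳ (q ^ suc (suc k)) | ℕₚ.*-zeroʳ (q ^ 1) = refl
  shiftG-pascal (suc N) (suc T) (suc k) (s≤s k≤N) = begin
    q ℕ.* q ^ k ℕ.* shiftG (suc N) (suc T) k
      ≡⟨ ℕₚ.*-assoc q (q ^ k) _ ⟩
    q ℕ.* (q ^ k ℕ.* shiftG (suc N) (suc T) k)
      ≡⟨ cong (q ℕ.*_) (shiftG-pascal N T k k≤N) ⟩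
    q ℕ.* (q ^ suc T ℕ.* shiftG N (suc T) k ℕ.+ q ^ k ℕ.* shiftG N T k)
      ≡⟨ distrib q (q ^ suc T) (shiftG N (suc T) k) (q ^ k) (shiftG N T k) ⟩
    q ^ suc (suc T) ℕ.* shiftG N (suc T) k ℕ.+ q ℕ.* q ^ k ℕ.* shiftG N T k ∎
    where
    open ≡-Reasoning
    distrib : ∀ q a x b y → q ℕ.* (a ℕ.* x ℕ.+ b ℕ.* y) ≡ q ℕ.* a ℕ.* x ℕ.+ q ℕ.* b ℕ.* y
    distrib = ℕ-Solver.solve-∀

  -- The summand of λ(a,b;s,t) at r, with n = a-s, c = b-a, T = t-s and k = r-s. In these
  -- parameters, raising n at fixed c moves a and b together.
  term : ℕ → ℕ → ℕ → ℕ → ℤ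
  term n c T k = weight k ℤ.* + G n k ℤ.* + shiftG (n ℕ.+ c) T k

  mobiusSum : ℕ → ℕ → ℕ → ℤ
  mobiusSum n c T = ∑ (suc T) (term n c T)

  pos-lin : ∀ a b c d → + (a ℕ.* b ℕ.+ c ℕ.* d) ≡ + a ℤ.* + b ℤ.+ + c ℤ.* + d
  pos-lin a b c d = trans (ℤₚ.pos-+ (a ℕ.* b) (c ℕ.* d)) (cong₂ ℤ._+_ (ℤₚ.pos-* a b) (ℤₚ.pos-* c d))

  private
    -- The part of a summand that comes from the second half of Pascal's rule. It enters `term-suc`
    -- at k+1 and, negated, at k, and so telescopes.
    lower : ℕ → ℕ → ℕ → ℕ → ℤ
    lower n c T k = weight k ℤ.* + (q ^ k) ℤ.* + G n k ℤ.* + shiftG (n ℕ.+ c) T k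

    stay : ∀ n c T k →
      weight k ℤ.* + (q ^ k) ℤ.* + G n k ℤ.* + shiftG (suc n ℕ.+ c) (suc T) k
        ≡ + (q ^ suc T) ℤ.* term n c (suc T) k ℤ.+ lower n c T k
    -- `shiftG-pascal` covers k ≤ n, which is at most n + c; beyond n the factor `G n k` makes both
    -- sides 0.
    stay n c T k with ℕₚ.≤-<-connex k n
    ... | inj₂ n<k rewrite G-vanish n k n<k =
      zeros (weight k) (+ (q ^ k)) (+ (q ^ suc T)) (+ shiftG (suc n ℕ.+ c) (suc T) k)
        (+ shiftG (n ℕ.+ c) (suc T) k) (+ shiftG (n ℕ.+ c) T k)
      where
      zeros : ∀ w a b x y z →
        w ℤ.* a ℤ.* + 0 ℤ.* x ≡ b ℤ.* (w ℤ.* + 0 ℤ.* y) ℤ.+ w ℤ.* a ℤ.* + 0 ℤ.* z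
      zeros = ℤ-Solver.solve-∀
    ... | inj₁ k≤n = begin
      weight k ℤ.* + (q ^ k) ℤ.* + G n k ℤ.* + shiftG (suc n ℕ.+ c) (suc T) k
        ≡⟨ move (weight k) (+ (q ^ k)) (+ G n k) (+ shiftG (suc n ℕ.+ c) (suc T) k) ⟩
      weight k ℤ.* + G n k ℤ.* (+ (q ^ k) ℤ.* + shiftG (suc n ℕ.+ c) (suc T) k)
        ≡⟨ cong (ℤ._*_ (weight k ℤ.* + G n k)) (trans (sym (ℤₚ.pos-* (q ^ k) _))
             (trans (cong +_ (shiftG-pascal (n ℕ.+ c) T k (ℕₚ.≤-trans k≤n (ℕₚ.m≤m+n n c))))
               (pos-lin (q ^ suc T) _ (q ^ k) _))) ⟩
      weight k ℤ.* + G n k ℤ.*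
        (+ (q ^ suc T) ℤ.* + shiftG (n ℕ.+ c) (suc T) k ℤ.+ + (q ^ k) ℤ.* + shiftG (n ℕ.+ c) T k)
        ≡⟨ split (weight k) (+ (q ^ k)) (+ G n k) (+ (q ^ suc T)) _ _ ⟩
      + (q ^ suc T) ℤ.* term n c (suc T) k ℤ.+ lower n c T k ∎
      where
      open ≡-Reasoning
      move : ∀ w a g x → w ℤ.* a ℤ.* g ℤ.* x ≡ w ℤ.* g ℤ.* (a ℤ.* x)
      move = ℤ-Solver.solve-∀
      split : ∀ w a g b x y →
        w ℤ.* g ℤ.* (b ℤ.* x ℤ.+ a ℤ.* y) ≡ b ℤ.* (w ℤ.* g ℤ.* x) ℤ.+ w ℤ.* a ℤ.* g ℤ.* y
      split = ℤ-Solver.solve-∀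

    -- Pascal's rule splits `G (suc n) (suc k)` in two. One part is `stay` at k+1; the other is
    -- minus `lower` at k, because the weight at k+1 is -q^k times the weight at k and `shiftG`
    -- cancels a common `suc`.
    term-suc : ∀ n c T k →
      term (suc n) c (suc T) (suc k)
        ≡ (+ (q ^ suc T) ℤ.* term n c (suc T) (suc k) ℤ.+ lower n c T (suc k)) ℤ.+ ℤ.- lower n c T k
    term-suc n c T k = begin
      weight (suc k) ℤ.* + (q ^ suc k ℕ.* G n (suc k) ℕ.+ G n k) ℤ.* + shiftG (n ℕ.+ c) T k
        ≡⟨ cong (λ z → weight (suc k) ℤ.* z ℤ.* + shiftG (n ℕ.+ c) T k)
             (trans (ℤₚ.pos-+ (q ^ suc k ℕ.* G n (suc k)) (G n k)) (cong (ℤ._+ + G n k) (ℤₚ.pos-* (q ^ suc k) (G n (suc k))))) ⟩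
      weight (suc k) ℤ.* (+ (q ^ suc k) ℤ.* + G n (suc k) ℤ.+ + G n k) ℤ.* + shiftG (n ℕ.+ c) T k
        ≡⟨ split (weight (suc k)) (+ (q ^ suc k)) (+ G n (suc k)) (+ G n k) _ ⟩
      weight (suc k) ℤ.* + (q ^ suc k) ℤ.* + G n (suc k) ℤ.* + shiftG (n ℕ.+ c) T k
        ℤ.+ weight (suc k) ℤ.* + G n k ℤ.* + shiftG (n ℕ.+ c) T k
        ≡⟨ cong₂ ℤ._+_ (stay n c T (suc k)) (trans (cong (λ w → w ℤ.* + G n k ℤ.* + shiftG (n ℕ.+ c) T k) (weight-suc k))
             (negate (weight k ℤ.* + (q ^ k)) (+ G n k) _)) ⟩
      (+ (q ^ suc T) ℤ.* term n c (suc T) (suc k) ℤ.+ lower n c T (suc k)) ℤ.+ ℤ.- lower n c T k ∎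
      where
      open ≡-Reasoning
      split : ∀ w a x y z → w ℤ.* (a ℤ.* x ℤ.+ y) ℤ.* z ≡ w ℤ.* a ℤ.* x ℤ.* z ℤ.+ w ℤ.* y ℤ.* z
      split = ℤ-Solver.solve-∀
      negate : ∀ w g x → (ℤ.- w) ℤ.* g ℤ.* x ≡ ℤ.- (w ℤ.* g ℤ.* x)
      negate = ℤ-Solver.solve-∀

    term-zero : ∀ n c T →
      term (suc n) c (suc T) 0 ≡ + (q ^ suc T) ℤ.* term n c (suc T) 0 ℤ.+ lower n c T 0
    term-zero n c T = trans (unit (+ shiftG (suc n ℕ.+ c) (suc T) 0)) (stay n c T 0)
      where
      unit : ∀ x → (+ 1 ℤ.* + 1) ℤ.* + 1 ℤ.* x ≡ (+ 1 ℤ.* + 1) ℤ.* + 1 ℤ.* + 1 ℤ.* x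
      unit = ℤ-Solver.solve-∀

    -- The induction runs over the cutoff K; `mobiusSum-suc` takes K = T+1, where the boundary term
    -- is 0.
    ∑-partial : ∀ K n c T →
      ∑ (suc K) (term (suc n) c (suc T)) ≡ + (q ^ suc T) ℤ.* ∑ (suc K) (term n c (suc T)) ℤ.+ lower n c T K
    ∑-partial zero n c T = trans (cong (ℤ._+ + 0) (term-zero n c T)) (shuffle (+ (q ^ suc T)) (term n c (suc T) 0) (lower n c T 0))
      where
      shuffle : ∀ a x y → (a ℤ.* x ℤ.+ y) ℤ.+ + 0 ≡ a ℤ.* (x ℤ.+ + 0) ℤ.+ y
      shuffle = ℤ-Solver.solve-∀
    ∑-partial (suc K) n c T = begin
      ∑ (suc (suc K)) (term (suc n) c (suc T))
        ≡⟨ ∑-last (suc K) (term (suc n) c (suc T)) ⟩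
      ∑ (suc K) (term (suc n) c (suc T)) ℤ.+ term (suc n) c (suc T) (suc K)
        ≡⟨ cong₂ ℤ._+_ (∑-partial K n c T) (term-suc n c T K) ⟩
      (+ (q ^ suc T) ℤ.* ∑ (suc K) (term n c (suc T)) ℤ.+ lower n c T K)
        ℤ.+ ((+ (q ^ suc T) ℤ.* term n c (suc T) (suc K) ℤ.+ lower n c T (suc K)) ℤ.+ ℤ.- lower n c T K)
        ≡⟨ shuffle (+ (q ^ suc T)) (∑ (suc K) (term n c (suc T))) (lower n c T K) (term n c (suc T) (suc K)) (lower n c T (suc K)) ⟩
      + (q ^ suc T) ℤ.* (∑ (suc K) (term n c (suc T)) ℤ.+ term n c (suc T) (suc K)) ℤ.+ lower n c T (suc K)
        ≡⟨ cong (λ z → + (q ^ suc T) ℤ.* z ℤ.+ lower n c T (suc K)) (∑-last (suc K) (term n c (suc T))) ⟨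
      + (q ^ suc T) ℤ.* ∑ (suc (suc K)) (term n c (suc T)) ℤ.+ lower n c T (suc K) ∎
      where
      open ≡-Reasoning
      shuffle : ∀ a S l t l′ → (a ℤ.* S ℤ.+ l) ℤ.+ ((a ℤ.* t ℤ.+ l′) ℤ.+ ℤ.- l) ≡ a ℤ.* (S ℤ.+ t) ℤ.+ l′
      shuffle = ℤ-Solver.solve-∀

  mobiusSum-suc : ∀ n c T → mobiusSum (suc n) c T ≡ + (q ^ T) ℤ.* mobiusSum n c T
  mobiusSum-suc n c zero    = refl
  mobiusSum-suc n c (suc T) = begin
    mobiusSum (suc n) c (suc T)
      ≡⟨ ∑-partial (suc T) n c T ⟩
    + (q ^ suc T) ℤ.* mobiusSum n c (suc T) ℤ.+ lower n c T (suc T)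
      ≡⟨ cong (λ z → + (q ^ suc T) ℤ.* mobiusSum n c (suc T) ℤ.+ z) vanish ⟩
    + (q ^ suc T) ℤ.* mobiusSum n c (suc T) ℤ.+ + 0
      ≡⟨ ℤₚ.+-identityʳ _ ⟩
    + (q ^ suc T) ℤ.* mobiusSum n c (suc T) ∎
    where
    open ≡-Reasoning
    vanish : lower n c T (suc T) ≡ + 0
    vanish rewrite shiftG-vanish (n ℕ.+ c) T (suc T) ℕₚ.≤-refl = ℤₚ.*-zeroʳ (weight (suc T) ℤ.* + (q ^ suc T) ℤ.* + G n (suc T))

  mobiusSum-zero : ∀ c T → mobiusSum 0 c T ≡ + G c T
  mobiusSum-zero c T = begin
    term 0 c T 0 ℤ.+ ∑ T (term 0 c T ∘ suc) ≡⟨ cong (ℤ._+_ (term 0 c T 0)) (∑-zero T _ vanish) ⟩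
    term 0 c T 0 ℤ.+ + 0                    ≡⟨ unit (+ G c T) ⟩
    + G c T ∎
    where
    open ≡-Reasoning
    vanish : ∀ i → i < T → term 0 c T (suc i) ≡ + 0
    vanish i _ rewrite ℤₚ.*-zeroʳ (weight (suc i)) = refl
    unit : ∀ x → (+ 1 ℤ.* + 1) ℤ.* + 1 ℤ.* x ℤ.+ + 0 ≡ x
    unit = ℤ-Solver.solve-∀

  mobiusSum-closed : ∀ n c T → mobiusSum n c T ≡ + (q ^ (n ℕ.* T) ℕ.* G c T)
  mobiusSum-closed zero    c T = trans (mobiusSum-zero c T) (cong +_ (sym (ℕₚ.*-identityˡ (G c T))))
  mobiusSum-closed (suc n) c T = begin
    mobiusSum (suc n) c T                                   ≡⟨ mobiusSum-suc n c T ⟩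
    + (q ^ T) ℤ.* mobiusSum n c T                           ≡⟨ cong (ℤ._*_ (+ (q ^ T))) (mobiusSum-closed n c T) ⟩
    + (q ^ T) ℤ.* + (q ^ (n ℕ.* T) ℕ.* G c T)       ≡⟨ ℤₚ.pos-* (q ^ T) _ ⟨
    + (q ^ T ℕ.* (q ^ (n ℕ.* T) ℕ.* G c T))         ≡⟨ cong +_ (ℕₚ.*-assoc (q ^ T) _ _) ⟨
    + (q ^ T ℕ.* q ^ (n ℕ.* T) ℕ.* G c T)           ≡⟨ cong (λ z → + (z ℕ.* G c T)) (ℕₚ.^-distribˡ-+-* q T (n ℕ.* T)) ⟨
    + (q ^ (T ℕ.+ n ℕ.* T) ℕ.* G c T) ∎
    where open ≡-Reasoning

  pos-cancel : ∀ s x y → y ≤ x → + (s ℕ.+ x) ℤ.- + (s ℕ.+ y) ≡ + (x ∸ y)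
  pos-cancel s x y y≤x = begin
    + (s ℕ.+ x) ℤ.- + (s ℕ.+ y)   ≡⟨ ℤₚ.[+m]-[+n]≡m⊖n (s ℕ.+ x) (s ℕ.+ y) ⟩
    (s ℕ.+ x) ℤ.⊖ (s ℕ.+ y)       ≡⟨ ℤₚ.⊖-≥ (ℕₚ.+-monoʳ-≤ s y≤x) ⟩
    + ((s ℕ.+ x) ∸ (s ℕ.+ y))     ≡⟨ cong +_ (ℕₚ.[m+n]∸[m+o]≡n∸o s x y) ⟩
    + (x ∸ y) ∎
    where open ≡-Reasoning

  gauss-shift : ∀ s x y z → z ≤ x → z ≤ y →
    gauss q (+ (s ℕ.+ x) ℤ.- + (s ℕ.+ z)) (+ (s ℕ.+ y) ℤ.- + (s ℕ.+ z)) ≡ + G (x ∸ z) (y ∸ z)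
  gauss-shift s x y z z≤x z≤y rewrite pos-cancel s x z z≤x | pos-cancel s y z z≤y =
    cong +_ (gaussℕ≡G (x ∸ z) (y ∸ z))

  private
    summand : (a b s t r : ℕ) → ℤ
    summand a b s t r = sign (r ∸ s) ℤ.* (+ (q ^ ((r ∸ s) C 2)))
      ℤ.* gauss q (+ a ℤ.- + s) (+ r ℤ.- + s)
      ℤ.* gauss q (+ b ℤ.- + r) (+ t ℤ.- + r)

  -- With a = s+n, b = s+n+c and t = s+T, the bound t ≤ b keeps all four differences in λ
  -- nonnegative, so `gauss` is evaluated by `gaussℕ` throughout.
  lam-closed : ∀ s n c T → T ≤ n ℕ.+ c →
    lam q (s ℕ.+ n) (s ℕ.+ (n ℕ.+ c)) s (s ℕ.+ T) ≡ + (q ^ (n ℕ.* T) ℕ.* G c T)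
  lam-closed s n c T T≤n+c = begin
    lam q (s ℕ.+ n) (s ℕ.+ (n ℕ.+ c)) s (s ℕ.+ T)
      ≡⟨ sumFromTo≡∑ s (s ℕ.+ T) f ⟩
    ∑ (suc (s ℕ.+ T) ∸ s) (λ k → f (s ℕ.+ k))
      ≡⟨ cong (λ K → ∑ K (λ k → f (s ℕ.+ k))) (trans (cong (_∸ s) (sym (ℕₚ.+-suc s T))) (ℕₚ.m+n∸m≡n s (suc T))) ⟩
    ∑ (suc T) (λ k → f (s ℕ.+ k))
      ≡⟨ ∑-cong (suc T) same ⟩
    mobiusSum n c T
      ≡⟨ mobiusSum-closed n c T ⟩
    + (q ^ (n ℕ.* T) ℕ.* G c T) ∎
    where
    open ≡-Reasoning
    f : ℕ → ℤ
    f = summand (s ℕ.+ n) (s ℕ.+ (n ℕ.+ c)) s (s ℕ.+ T)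
    same : ∀ k → k < suc T → f (s ℕ.+ k) ≡ term n c T k
    same k (s≤s k≤T) = cong₂ ℤ._*_
      (cong₂ ℤ._*_ (cong weight (ℕₚ.m+n∸m≡n s k))
        (trans (cong (λ z → gauss q (+ (s ℕ.+ n) ℤ.- + z) (+ (s ℕ.+ k) ℤ.- + z)) (sym (ℕₚ.+-identityʳ s)))
          (gauss-shift s n k 0 z≤n z≤n)))
      (trans (gauss-shift s (n ℕ.+ c) T k (ℕₚ.≤-trans k≤T T≤n+c) k≤T)
        (cong +_ (sym (shiftG≡G (n ℕ.+ c) T k (ℕₚ.≤-trans k≤T T≤n+c) k≤T))))

  lam-empty : ∀ a b s t → t < s → lam q a b s t ≡ + 0
  lam-empty a b s t t<s = sumFromTo-empty s t (summand a b s t) t<s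

-- Booleans, finite functions and powers

∧-elimˡ : ∀ {a b} → a ∧ b ≡ true → a ≡ true
∧-elimˡ {true} _ = refl

∧-elimʳ : ∀ {a b} → a ∧ b ≡ true → b ≡ true
∧-elimʳ {true} e = e

∧-intro : ∀ {a b} → a ≡ true → b ≡ true → a ∧ b ≡ true
∧-intro refl refl = refl

bool-ext : ∀ {a b} → (a ≡ true → b ≡ true) → (b ≡ true → a ≡ true) → a ≡ b
bool-ext {true}  {b}     f g = sym (f refl)
bool-ext {false} {true}  f g = g refl
bool-ext {false} {false} f g = refl

⌊⌋-true : ∀ {P : Set} (P? : Dec P) → P → ⌊ P? ⌋ ≡ true
⌊⌋-true (yes _) _ = refl
⌊⌋-true (no ¬p) p = ⊥-elim (¬p p)

true-⌊⌋ : ∀ {P : Set} (P? : Dec P) → ⌊ P? ⌋ ≡ true → P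
true-⌊⌋ (yes p) _ = p

foldr-∧-elim : ∀ {n} (f : Fin n → Bool) →
  Vec.foldr _ _∧_ true (tabulate f) ≡ true → ∀ k → f k ≡ true
foldr-∧-elim f e Fin.zero    = ∧-elimˡ e
foldr-∧-elim f e (Fin.suc k) = foldr-∧-elim (f ∘ Fin.suc) (∧-elimʳ {f Fin.zero} e) k

foldr-∧-intro : ∀ {n} (f : Fin n → Bool) →
  (∀ k → f k ≡ true) → Vec.foldr _ _∧_ true (tabulate f) ≡ true
foldr-∧-intro {zero}  f e = refl
foldr-∧-intro {suc n} f e = ∧-intro (e Fin.zero) (foldr-∧-intro (f ∘ Fin.suc) (e ∘ Fin.suc))

funToFin-cong : ∀ {m n} {f g : Fin m → Fin n} → (∀ i → f i ≡ g i) → funToFin f ≡ funToFin g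
funToFin-cong {zero}  e = refl
funToFin-cong {suc m} e = cong₂ Fin.combine (e Fin.zero) (funToFin-cong (e ∘ Fin.suc))

finToFun-injective : ∀ {m n} (i j : Fin (n ^ m)) → (∀ k → finToFun {n} {m} i k ≡ finToFun j k) → i ≡ j
finToFun-injective {m} {n} i j e =
  trans (sym (Finₚ.funToFin-finToFin {m} {n} i)) (trans (funToFin-cong e) (Finₚ.funToFin-finToFin {m} {n} j))

lookup-injective : ∀ {A : Set} {n} (v w : Vec A n) → (∀ k → lookup v k ≡ lookup w k) → v ≡ w
lookup-injective v w e =
  trans (sym (Vecₚ.tabulate∘lookup v)) (trans (Vecₚ.tabulate-cong e) (Vecₚ.tabulate∘lookup w))

^-injective : ∀ q d e → 2 ≤ q → q ^ d ≡ q ^ e → d ≡ e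
^-injective q d e 2≤q eq = ℕₚ.≤-antisym (≮⇒≥′ (sym eq)) (≮⇒≥′ eq)
  where
  ≮⇒≥′ : ∀ {i j} → q ^ i ≡ q ^ j → j ≤ i
  ≮⇒≥′ eq′ = ℕₚ.≮⇒≥ (λ i<j → ℕₚ.<-irrefl eq′ (ℕₚ.^-monoʳ-< q 2≤q i<j))

-- Echelon forms of W ⊆ F_q^n. Let W̄ be the image of W under deletion of the first coordinate.
-- Either e_1 ∈ W and W = F_q × W̄ (jump), or W is the graph over W̄ of a linear functional
-- (skip c, with c its values on the canonical basis of W̄).
data Echelon (q : ℕ) : ℕ → ℕ → Set where
  nil  : Echelon q 0 0
  jump : ∀ {n e} → Echelon q n e → Echelon q (suc n) (suc e)
  skip : ∀ {n e} → Vec (Fin q) e → Echelon q n e → Echelon q (suc n) e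

jumps : ∀ {q n e} → Echelon q n e → ℕ → ℕ
jumps x          zero    = 0
jumps nil        (suc j) = 0
jumps (jump x)   (suc j) = suc (jumps x j)
jumps (skip _ x) (suc j) = jumps x j

jumps-suc-≤ : ∀ {q n e} (x : Echelon q n e) j → jumps x (suc j) ≤ suc (jumps x j)
jumps-suc-≤ nil        zero    = z≤n
jumps-suc-≤ nil        (suc j) = z≤n
jumps-suc-≤ (jump x)   zero    = s≤s z≤n
jumps-suc-≤ (skip _ x) zero    = z≤n
jumps-suc-≤ (jump x)   (suc j) = s≤s (jumps-suc-≤ x j)
jumps-suc-≤ (skip _ x) (suc j) = jumps-suc-≤ x j

module Subspaces {q : ℕ} (F : FiniteField q) where
  open FiniteField F
  open module L {n : ℕ} = LinAlg F n
    using (zeroV; _⊕_; _⊙_; IsSubspace; lincomb; LinIndep; HasDim; DimGE; A; _∩_; _≈S_; InSchubert)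

  Subset : ℕ → Set
  Subset n = Vec (Fin q) n → Bool

  commutativeRing : CommutativeRing _ _
  commutativeRing = record { isCommutativeRing = isCommutativeRing }

  open CommutativeRing commutativeRing using
    (+-identityˡ; +-identityʳ; *-identityˡ; *-comm; *-assoc; distribˡ; distribʳ; zeroʳ; -‿inverseʳ; ring)
  open Algebra.Properties.Ring ring using (-1*x≈-x)
  open Algebra.Properties.CommutativeSemigroup (CommutativeRing.+-commutativeSemigroup commutativeRing) using (interchange; x∙yz≈y∙xz)

  two≤q : 2 ≤ q
  two≤q = go _ 0# 1# 0≢1
    where
    go : ∀ q (a b : Fin q) → ¬ (a ≡ b) → 2 ≤ q
    go (suc zero)    Fin.zero Fin.zero a≢b = ⊥-elim (a≢b refl)
    go (suc (suc q)) _        _        _   = s≤s (s≤s z≤n)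

  -- Coordinate vectors

  ⊕-identityˡ : ∀ {n} (v : Vec (Fin q) n) → zeroV ⊕ v ≡ v
  ⊕-identityˡ []      = refl
  ⊕-identityˡ (a ∷ v) = cong₂ _∷_ (+-identityˡ a) (⊕-identityˡ v)

  ⊕-identityʳ : ∀ {n} (v : Vec (Fin q) n) → v ⊕ zeroV ≡ v
  ⊕-identityʳ []      = refl
  ⊕-identityʳ (a ∷ v) = cong₂ _∷_ (+-identityʳ a) (⊕-identityʳ v)

  ⊕-interchange : ∀ {n} (v w x y : Vec (Fin q) n) → (v ⊕ w) ⊕ (x ⊕ y) ≡ (v ⊕ x) ⊕ (w ⊕ y)
  ⊕-interchange []      []      []      []      = refl
  ⊕-interchange (a ∷ v) (b ∷ w) (c ∷ x) (d ∷ y) = cong₂ _∷_ (interchange a b c d) (⊕-interchange v w x y)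

  ⊙-distribˡ : ∀ {n} a (v w : Vec (Fin q) n) → a ⊙ (v ⊕ w) ≡ (a ⊙ v) ⊕ (a ⊙ w)
  ⊙-distribˡ a []      []      = refl
  ⊙-distribˡ a (b ∷ v) (c ∷ w) = cong₂ _∷_ (distribˡ a b c) (⊙-distribˡ a v w)

  ⊙-distribʳ : ∀ {n} a b (v : Vec (Fin q) n) → (a + b) ⊙ v ≡ (a ⊙ v) ⊕ (b ⊙ v)
  ⊙-distribʳ a b []      = refl
  ⊙-distribʳ a b (c ∷ v) = cong₂ _∷_ (distribʳ c a b) (⊙-distribʳ a b v)

  ⊙-assoc : ∀ {n} a b (v : Vec (Fin q) n) → (a * b) ⊙ v ≡ a ⊙ (b ⊙ v)
  ⊙-assoc a b []      = refl
  ⊙-assoc a b (c ∷ v) = cong₂ _∷_ (*-assoc a b c) (⊙-assoc a b v)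

  ⊙-zeroʳ : ∀ {n} a → a ⊙ zeroV {n} ≡ zeroV
  ⊙-zeroʳ {zero}  a = refl
  ⊙-zeroʳ {suc n} a = cong₂ _∷_ (zeroʳ a) (⊙-zeroʳ a)

  ⊕-inverseʳ : ∀ {n} (v : Vec (Fin q) n) → v ⊕ ((- 1#) ⊙ v) ≡ zeroV
  ⊕-inverseʳ []      = refl
  ⊕-inverseʳ (a ∷ v) = cong₂ _∷_ (trans (cong (λ z → a + z) (-1*x≈-x a)) (-‿inverseʳ a)) (⊕-inverseʳ v)

  +-move : ∀ a b → a + (b + (- a)) ≡ b
  +-move a b = trans (x∙yz≈y∙xz a b (- a)) (trans (cong (λ z → b + z) (-‿inverseʳ a)) (+-identityʳ b))

  sub-zero⇒≡ : ∀ a b → a + ((- 1#) * b) ≡ 0# → a ≡ b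
  sub-zero⇒≡ a b e = begin
    a                ≡⟨ +-move b a ⟨
    b + (a + (- b))    ≡⟨ cong (λ z → b + z) (trans (cong (λ z → a + z) (sym (-1*x≈-x b))) e) ⟩
    b + 0#           ≡⟨ +-identityʳ b ⟩
    b ∎
    where open ≡-Reasoning

  dot : ∀ {n} → Vec (Fin q) n → Vec (Fin q) n → Fin q
  dot []      []      = 0#
  dot (a ∷ c) (b ∷ y) = (a * b) + dot c y

  dot-⊕ : ∀ {n} (c v w : Vec (Fin q) n) → dot c (v ⊕ w) ≡ dot c v + dot c w
  dot-⊕ []      []      []      = sym (+-identityˡ 0#)
  dot-⊕ (a ∷ c) (x ∷ v) (y ∷ w) =
    trans (cong₂ _+_ (distribˡ a x y) (dot-⊕ c v w)) (interchange (a * x) (a * y) (dot c v) (dot c w))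

  dot-⊙ : ∀ {n} (c : Vec (Fin q) n) k v → dot c (k ⊙ v) ≡ k * dot c v
  dot-⊙ []      k []      = sym (zeroʳ k)
  dot-⊙ (a ∷ c) k (x ∷ v) = trans
    (cong₂ _+_ (trans (sym (*-assoc a k x)) (trans (cong (_* x) (*-comm a k)) (*-assoc k a x))) (dot-⊙ c k v))
    (sym (distribˡ k (a * x) (dot c v)))

  dot-zero : ∀ {n} (c : Vec (Fin q) n) → dot c zeroV ≡ 0#
  dot-zero []      = refl
  dot-zero (a ∷ c) = trans (cong₂ _+_ (zeroʳ a) (dot-zero c)) (+-identityʳ 0#)

  unit : ∀ {n} → Fin n → Vec (Fin q) n
  unit Fin.zero    = 1# ∷ zeroV
  unit (Fin.suc k) = 0# ∷ unit k

  dot-unit : ∀ {n} (c : Vec (Fin q) n) k → dot c (unit k) ≡ lookup c k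
  dot-unit (a ∷ c) Fin.zero    =
    trans (cong₂ _+_ (trans (*-comm a 1#) (*-identityˡ a)) (dot-zero c)) (+-identityʳ a)
  dot-unit (a ∷ c) (Fin.suc k) = trans (cong₂ _+_ (zeroʳ a) (dot-unit c k)) (+-identityˡ _)

  -- Linear combinations

  lincomb-cong : ∀ {n d} {c c′ : Fin d → Fin q} (b : Fin d → Vec (Fin q) n) →
    (∀ k → c k ≡ c′ k) → lincomb c b ≡ lincomb c′ b
  lincomb-cong {d = zero}  b e = refl
  lincomb-cong {d = suc d} b e = cong₂ _⊕_ (cong (_⊙ b Fin.zero) (e Fin.zero)) (lincomb-cong (b ∘ Fin.suc) (e ∘ Fin.suc))

  lincomb-⊕ : ∀ {n d} (c c′ : Fin d → Fin q) (b : Fin d → Vec (Fin q) n) →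
    lincomb (λ k → c k + c′ k) b ≡ lincomb c b ⊕ lincomb c′ b
  lincomb-⊕ {d = zero}  c c′ b = sym (⊕-identityˡ zeroV)
  lincomb-⊕ {d = suc d} c c′ b = trans
    (cong₂ _⊕_ (⊙-distribʳ _ _ _) (lincomb-⊕ (c ∘ Fin.suc) (c′ ∘ Fin.suc) (b ∘ Fin.suc)))
    (⊕-interchange _ _ _ _)

  lincomb-⊙ : ∀ {n d} a (c : Fin d → Fin q) (b : Fin d → Vec (Fin q) n) →
    lincomb (λ k → a * c k) b ≡ a ⊙ lincomb c b
  lincomb-⊙ {d = zero}  a c b = sym (⊙-zeroʳ a)
  lincomb-⊙ {d = suc d} a c b = trans
    (cong₂ _⊕_ (⊙-assoc _ _ _) (lincomb-⊙ a (c ∘ Fin.suc) (b ∘ Fin.suc)))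
    (sym (⊙-distribˡ _ _ _))

  lincomb-injective : ∀ {n d} {b : Fin d → Vec (Fin q) n} → LinIndep b →
    ∀ c c′ → lincomb c b ≡ lincomb c′ b → ∀ k → c k ≡ c′ k
  lincomb-injective {b = b} indep c c′ e k =
    sub-zero⇒≡ (c k) (c′ k) (indep (λ j → c j + ((- 1#) * c′ j)) vanish k)
    where
    vanish : lincomb (λ j → c j + ((- 1#) * c′ j)) b ≡ zeroV
    vanish = trans (lincomb-⊕ c (λ j → (- 1#) * c′ j) b)
      (trans (cong₂ _⊕_ e (lincomb-⊙ (- 1#) c′ b)) (⊕-inverseʳ (lincomb c′ b)))

  lincomb-∈ : ∀ {n d} {W : Subset n} → IsSubspace W → (c : Fin d → Fin q) (b : Fin d → Vec (Fin q) n) →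
    (∀ k → W (b k) ≡ true) → W (lincomb c b) ≡ true
  lincomb-∈ {d = zero}  (z , _ , _)         c b ∈W = z
  lincomb-∈ {d = suc d} sub@(_ , plus , scale) c b ∈W =
    plus _ _ (scale _ _ (∈W Fin.zero)) (lincomb-∈ sub (c ∘ Fin.suc) (b ∘ Fin.suc) (∈W ∘ Fin.suc))

  lincomb-0∷ : ∀ {n d} (c : Fin d → Fin q) (b : Fin d → Vec (Fin q) n) →
    lincomb c (λ k → 0# ∷ b k) ≡ 0# ∷ lincomb c b
  lincomb-0∷ {d = zero}  c b = refl
  lincomb-0∷ {d = suc d} c b = trans
    (cong ((c Fin.zero ⊙ (0# ∷ b Fin.zero)) ⊕_) (lincomb-0∷ (c ∘ Fin.suc) (b ∘ Fin.suc)))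
    (cong (_∷ lincomb c b) (trans (cong (_+ 0#) (zeroʳ _)) (+-identityʳ 0#)))

  lincomb-unit : ∀ {d} (c : Fin d → Fin q) → lincomb c unit ≡ tabulate c
  lincomb-unit {zero}  c = refl
  lincomb-unit {suc d} c = begin
    (c Fin.zero ⊙ (1# ∷ zeroV)) ⊕ lincomb (c ∘ Fin.suc) (λ k → 0# ∷ unit k)
      ≡⟨ cong₂ _⊕_ (cong₂ _∷_ (trans (*-comm _ 1#) (*-identityˡ _)) (⊙-zeroʳ (c Fin.zero)))
                   (trans (lincomb-0∷ (c ∘ Fin.suc) unit) (cong (0# ∷_) (lincomb-unit (c ∘ Fin.suc)))) ⟩
    (c Fin.zero + 0#) ∷ (zeroV ⊕ tabulate (c ∘ Fin.suc))
      ≡⟨ cong₂ _∷_ (+-identityʳ _) (⊕-identityˡ _) ⟩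
    tabulate c ∎
    where open ≡-Reasoning

  -- The subspace of an echelon form

  -- The entries at the jump coordinates. They are read off any vector, member or not, because `mem`
  -- evaluates the functional of a skip on tails that need not be members.
  coords : ∀ {n e} → Echelon q n e → Vec (Fin q) n → Vec (Fin q) e
  coords nil        []      = []
  coords (jump x)   (a ∷ v) = a ∷ coords x v
  coords (skip _ x) (_ ∷ v) = coords x v

  mem : ∀ {n e} → Echelon q n e → Subset n
  mem nil        []      = true
  mem (jump x)   (a ∷ v) = mem x v
  mem (skip c x) (a ∷ v) = ⌊ a Fin.≟ dot c (coords x v) ⌋ ∧ mem x v

  param : ∀ {n e} → Echelon q n e → Vec (Fin q) e → Vec (Fin q) n
  param nil        []      = []
  param (jump x)   (a ∷ y) = a ∷ param x y
  param (skip c x) y       = dot c y ∷ param x y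

  coords-zero : ∀ {n e} (x : Echelon q n e) → coords x zeroV ≡ zeroV
  coords-zero nil        = refl
  coords-zero (jump x)   = cong (0# ∷_) (coords-zero x)
  coords-zero (skip c x) = coords-zero x

  param-⊕ : ∀ {n e} (x : Echelon q n e) v w → param x (v ⊕ w) ≡ param x v ⊕ param x w
  param-⊕ nil        []      []      = refl
  param-⊕ (jump x)   (a ∷ v) (b ∷ w) = cong (_ ∷_) (param-⊕ x v w)
  param-⊕ (skip c x) v       w       = cong₂ _∷_ (dot-⊕ c v w) (param-⊕ x v w)

  param-⊙ : ∀ {n e} (x : Echelon q n e) k v → param x (k ⊙ v) ≡ k ⊙ param x v
  param-⊙ nil        k []      = refl
  param-⊙ (jump x)   k (a ∷ v) = cong (_ ∷_) (param-⊙ x k v)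
  param-⊙ (skip c x) k v       = cong₂ _∷_ (dot-⊙ c k v) (param-⊙ x k v)

  param-zero : ∀ {n e} (x : Echelon q n e) → param x zeroV ≡ zeroV
  param-zero nil        = refl
  param-zero (jump x)   = cong (0# ∷_) (param-zero x)
  param-zero (skip c x) = cong₂ _∷_ (dot-zero c) (param-zero x)

  coords-param : ∀ {n e} (x : Echelon q n e) y → coords x (param x y) ≡ y
  coords-param nil        []      = refl
  coords-param (jump x)   (a ∷ y) = cong (a ∷_) (coords-param x y)
  coords-param (skip c x) y       = coords-param x y

  mem-param : ∀ {n e} (x : Echelon q n e) y → mem x (param x y) ≡ true
  mem-param nil        []      = refl
  mem-param (jump x)   (a ∷ y) = mem-param x y
  mem-param (skip c x) y       =
    ∧-intro (⌊⌋-true (_ Fin.≟ _) (cong (dot c) (sym (coords-param x y)))) (mem-param x y)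

  param-coords : ∀ {n e} (x : Echelon q n e) v → mem x v ≡ true → param x (coords x v) ≡ v
  param-coords nil        []      _  = refl
  param-coords (jump x)   (a ∷ v) ∈x = cong (a ∷_) (param-coords x v ∈x)
  param-coords (skip c x) (a ∷ v) ∈x =
    cong₂ _∷_ (sym (true-⌊⌋ (a Fin.≟ dot c (coords x v)) (∧-elimˡ ∈x))) (param-coords x v (∧-elimʳ ∈x))

  -- The set is the image of the linear map `param x`, and `coords x` recovers a preimage of each
  -- member, so closure is carried over from F_q^e.
  mem-subspace : ∀ {n e} (x : Echelon q n e) → IsSubspace (mem x)
  mem-subspace x =
      subst (λ v → mem x v ≡ true) (param-zero x) (mem-param x zeroV)
    , (λ v w v∈ w∈ → subst (λ v → mem x v ≡ true)
        (trans (param-⊕ x _ _) (cong₂ _⊕_ (param-coords x v v∈) (param-coords x w w∈))) (mem-param x (coords x v ⊕ coords x w)))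
    , (λ c v v∈ → subst (λ v → mem x v ≡ true)
        (trans (param-⊙ x c _) (cong (c ⊙_) (param-coords x v v∈))) (mem-param x (c ⊙ coords x v)))

  lincomb-param : ∀ {n e d} (x : Echelon q n e) (c : Fin d → Fin q) b →
    lincomb c (param x ∘ b) ≡ param x (lincomb c b)
  lincomb-param {d = zero}  x c b = sym (param-zero x)
  lincomb-param {d = suc d} x c b = trans
    (cong₂ _⊕_ (sym (param-⊙ x _ _)) (lincomb-param x (c ∘ Fin.suc) (b ∘ Fin.suc)))
    (sym (param-⊕ x _ _))

  basis : ∀ {n e} → Echelon q n e → Fin e → Vec (Fin q) n
  basis x k = param x (unit k)

  lincomb-basis : ∀ {n e} (x : Echelon q n e) (c : Fin e → Fin q) → lincomb c (basis x) ≡ param x (tabulate c)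
  lincomb-basis x c = trans (lincomb-param x c unit) (cong (param x) (lincomb-unit c))

  basis-spans : ∀ {n e} (x : Echelon q n e) y → lincomb (lookup y) (basis x) ≡ param x y
  basis-spans x y = trans (lincomb-basis x (lookup y)) (cong (param x) (Vecₚ.tabulate∘lookup y))

  mem-hasDim : ∀ {n e} (x : Echelon q n e) → HasDim (mem x) e
  mem-hasDim x = basis x , (λ k → mem-param x (unit k)) , indep
    , λ v v∈ → lookup (coords x v) , trans (basis-spans x (coords x v)) (param-coords x v v∈)
    where
    indep : LinIndep (basis x)
    indep c e k = begin
      c k                       ≡⟨ Vecₚ.lookup∘tabulate c k ⟨
      lookup (tabulate c) k     ≡⟨ cong (λ y → lookup y k) tabulate≡0 ⟩
      lookup zeroV k            ≡⟨ Vecₚ.lookup-replicate k 0# ⟩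
      0# ∎
      where
      open ≡-Reasoning
      tabulate≡0 : tabulate c ≡ zeroV
      tabulate≡0 = trans (sym (coords-param x (tabulate c)))
        (trans (cong (coords x) (trans (sym (lincomb-basis x c)) e)) (coords-zero x))

  hasDim-cong : ∀ {n d} {U W : Subset n} → U ≈S W → HasDim U d → HasDim W d
  hasDim-cong U≈W (b , b∈ , indep , spans) =
    b , (λ k → trans (sym (U≈W (b k))) (b∈ k)) , indep , λ v v∈ → spans v (trans (U≈W v) v∈)

  -- Both U and Fq^e are counted: q^d = |U| = q^e.
  dim-unique : ∀ {n d e} {U : Subset n} (x : Echelon q n e) → U ≈S mem x → HasDim U d → d ≡ e
  dim-unique {n} {d} {e} {U} x U≈x (b , b∈ , indep , spans) =
    ^-injective q d e two≤q (ℕₚ.≤-antisym (Finₚ.injective⇒≤ to-injective) (Finₚ.injective⇒≤ from-injective))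
    where
    comb∈ : ∀ c → mem x (lincomb c b) ≡ true
    comb∈ c = lincomb-∈ (mem-subspace x) c b (λ k → trans (sym (U≈x (b k))) (b∈ k))

    to : Fin (q ^ d) → Fin (q ^ e)
    to i = funToFin (lookup (coords x (lincomb (finToFun {q} {d} i) b)))

    to-injective : ∀ {i j} → to i ≡ to j → i ≡ j
    to-injective {i} {j} eq = finToFun-injective {d} {q} i j (lincomb-injective indep ci cj (begin
      lincomb ci b                            ≡⟨ param-coords x _ (comb∈ ci) ⟨
      param x (coords x (lincomb ci b))       ≡⟨ cong (param x) (lookup-injective _ _ λ k →
        trans (sym (Finₚ.finToFun-funToFin (lookup (coords x (lincomb ci b))) k))
          (trans (cong (λ z → finToFun z k) eq) (Finₚ.finToFun-funToFin (lookup (coords x (lincomb cj b))) k))) ⟩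
      param x (coords x (lincomb cj b))       ≡⟨ param-coords x _ (comb∈ cj) ⟩
      lincomb cj b ∎))
      where
      open ≡-Reasoning
      ci cj : Fin d → Fin q
      ci = finToFun i
      cj = finToFun j

    point : Fin (q ^ e) → Vec (Fin q) n
    point i = param x (tabulate (finToFun {q} {e} i))

    solve : ∀ i → ∃ λ c → lincomb c b ≡ point i
    solve i = spans (point i) (trans (U≈x _) (mem-param x _))

    from : Fin (q ^ e) → Fin (q ^ d)
    from i = funToFin (proj₁ (solve i))

    from-injective : ∀ {i j} → from i ≡ from j → i ≡ j
    from-injective {i} {j} eq = finToFun-injective {e} {q} i j λ k → begin
      finToFun i k                                    ≡⟨ Vecₚ.lookup∘tabulate (finToFun i) k ⟨
      lookup (tabulate (finToFun i)) k                ≡⟨ cong (λ y → lookup y k) same ⟩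
      lookup (tabulate (finToFun j)) k                ≡⟨ Vecₚ.lookup∘tabulate (finToFun j) k ⟩
      finToFun j k ∎
      where
      open ≡-Reasoning
      same-coeff : ∀ k → proj₁ (solve i) k ≡ proj₁ (solve j) k
      same-coeff k = trans (sym (Finₚ.finToFun-funToFin (proj₁ (solve i)) k))
        (trans (cong (λ z → finToFun z k) eq) (Finₚ.finToFun-funToFin (proj₁ (solve j)) k))
      same : tabulate (finToFun {q} {e} i) ≡ tabulate (finToFun {q} {e} j)
      same = trans (sym (coords-param x _)) (trans (cong (coords x)
        (trans (sym (proj₂ (solve i))) (trans (lincomb-cong b same-coeff) (proj₂ (solve j))))) (coords-param x _))

  -- e_1 lies in the subspace of every jump and of no skip, which separates the two. For two skips
  -- the tails agree first, and then the functionals, compared on the canonical basis.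
  mem-injective : ∀ {n e} (x y : Echelon q n e) → mem x ≈S mem y → x ≡ y
  mem-injective nil        nil        _  = refl
  mem-injective (jump x)   (jump y)   eq = cong jump (mem-injective x y (λ v → eq (0# ∷ v)))
  mem-injective (jump x)   (skip c y) eq = ⊥-elim (0≢1 (sym (trans
    (true-⌊⌋ (_ Fin.≟ _) (∧-elimˡ (trans (sym (eq (1# ∷ zeroV))) (proj₁ (mem-subspace x)))))
    (trans (cong (dot c) (coords-zero y)) (dot-zero c)))))
  mem-injective (skip c x) (jump y)   eq = ⊥-elim (0≢1 (sym (trans
    (true-⌊⌋ (_ Fin.≟ _) (∧-elimˡ (trans (eq (1# ∷ zeroV)) (proj₁ (mem-subspace y)))))
    (trans (cong (dot c) (coords-zero x)) (dot-zero c)))))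
  mem-injective (skip c x) (skip c′ y) eq
    with mem-injective x y (λ v → bool-ext
      -- A member v of the tail space becomes a member of the whole by taking its functional value
      -- as first entry.
      (λ v∈ → ∧-elimʳ (trans (sym (eq (dot c (coords x v) ∷ v))) (∧-intro (⌊⌋-true (_ Fin.≟ _) refl) v∈)))
      (λ v∈ → ∧-elimʳ (trans (eq (dot c′ (coords y v) ∷ v)) (∧-intro (⌊⌋-true (_ Fin.≟ _) refl) v∈))))
  ... | refl = cong (λ z → skip z x) (lookup-injective c c′ λ k → begin
    lookup c k          ≡⟨ dot-unit c k ⟨
    dot c (unit k)      ≡⟨ true-⌊⌋ (_ Fin.≟ _) (∧-elimˡ (trans (sym (eq (param (skip c x) (unit k)))) (mem-param (skip c x) (unit k)))) ⟩
    dot c′ (coords x (param x (unit k))) ≡⟨ cong (dot c′) (coords-param x (unit k)) ⟩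
    dot c′ (unit k)     ≡⟨ dot-unit c′ k ⟩
    lookup c′ k ∎)
    where open ≡-Reasoning

  -- Every subspace has an echelon form

  tails : ∀ {n} → Subset (suc n) → Subset n
  tails W v = ⌊ Finₚ.any? (λ a → W (a ∷ v) Bool.≟ true) ⌋

  tails-intro : ∀ {n} (W : Subset (suc n)) a v → W (a ∷ v) ≡ true → tails W v ≡ true
  tails-intro W a v ∈W = ⌊⌋-true (Finₚ.any? _) (a , ∈W)

  tails-elim : ∀ {n} (W : Subset (suc n)) v → tails W v ≡ true → ∃ λ a → W (a ∷ v) ≡ true
  tails-elim W v = true-⌊⌋ (Finₚ.any? _)

  tails-subspace : ∀ {n} (W : Subset (suc n)) → IsSubspace W → IsSubspace (tails W)
  tails-subspace W (z , plus , scale) = tails-intro W 0# zeroV z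
    , (λ v w v∈ w∈ → let a , p = tails-elim W v v∈ ; b , r = tails-elim W w w∈ in tails-intro W (a + b) _ (plus _ _ p r))
    , (λ c v v∈ → let a , p = tails-elim W v v∈ in tails-intro W (c * a) _ (scale c _ p))

  -- The number of jumps, computed from the characteristic function alone: it gives `echelonOf` a
  -- size index before any basis is known. For a subspace it is the dimension, by `dim-unique`.
  rank : ∀ {n} → Subset n → ℕ
  rank {zero}  W = 0
  rank {suc n} W = if W (1# ∷ zeroV) then suc (rank (tails W)) else rank (tails W)

  rank-jump : ∀ {n} (W : Subset (suc n)) → W (1# ∷ zeroV) ≡ true → rank W ≡ suc (rank (tails W))
  rank-jump W e₁ rewrite e₁ = refl

  rank-skip : ∀ {n} (W : Subset (suc n)) → ¬ (W (1# ∷ zeroV) ≡ true) → rank W ≡ rank (tails W)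
  rank-skip W ¬e₁ with W (1# ∷ zeroV)
  ... | true  = ⊥-elim (¬e₁ refl)
  ... | false = refl

  rank-cong : ∀ {n} (U W : Subset n) → U ≈S W → rank U ≡ rank W
  rank-cong {zero}  U W eq = refl
  rank-cong {suc n} U W eq rewrite eq (1# ∷ zeroV) =
    cong (λ r → if W (1# ∷ zeroV) then suc r else r) (rank-cong (tails U) (tails W) λ v → bool-ext
      (λ v∈ → let a , p = tails-elim U v v∈ in tails-intro W a v (trans (sym (eq _)) p))
      (λ v∈ → let a , p = tails-elim W v v∈ in tails-intro U a v (trans (eq _) p)))

  -- If e_1 is outside W, every tail has exactly one first entry. The vector c collects these
  -- entries for the basis of the tail space, and linearity fixes the others.
  echelonOf : ∀ {n} (W : Subset n) → IsSubspace W → Σ (Echelon q n (rank W)) λ x → W ≈S mem x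
  echelonOf {zero}  W (z , _) = nil , λ { [] → z }
  echelonOf {suc n} W sub@(z , plus , scale) with echelonOf (tails W) (tails-subspace W sub) | W (1# ∷ zeroV) in e₁
  ... | x , W≈x | true = jump x , λ { (a ∷ v) → bool-ext
          (λ ∈W → trans (sym (W≈x v)) (tails-intro W a v ∈W))
          -- Some b ∷ v lies in W; a multiple of e_1 corrects its first entry to a.
          (λ ∈x → let b , p = tails-elim W v (trans (W≈x v) ∈x) in
            subst (λ w → W w ≡ true) (shear a b v) (plus _ _ p (scale (a + (- b)) _ e₁))) }
    where
    shear : ∀ a b v → (b ∷ v) ⊕ ((a + (- b)) ⊙ (1# ∷ zeroV)) ≡ a ∷ v
    shear a b v = cong₂ _∷_
      (trans (cong (λ z → b + z) (trans (*-comm _ 1#) (*-identityˡ _))) (+-move b a))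
      (trans (cong (v ⊕_) (⊙-zeroʳ _)) (⊕-identityʳ v))
  ... | x , W≈x | false = skip c x , λ { (a ∷ v) → bool-ext (complete a v)
          (λ ∈x → subst (λ w → W w ≡ true) (param-coords (skip c x) (a ∷ v) ∈x) (sound (coords x v))) }
    where
    lift : ∀ k → ∃ λ a → W (a ∷ basis x k) ≡ true
    lift k = tails-elim W _ (trans (W≈x _) (mem-param x (unit k)))

    c : Vec (Fin q) (rank (tails W))
    c = tabulate (proj₁ ∘ lift)

    basis∈ : ∀ k → W (basis (skip c x) k) ≡ true
    basis∈ k = subst (λ a → W (a ∷ basis x k) ≡ true)
      (sym (trans (dot-unit c k) (Vecₚ.lookup∘tabulate (proj₁ ∘ lift) k))) (proj₂ (lift k))

    sound : ∀ y → W (param (skip c x) y) ≡ true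
    sound y = subst (λ w → W w ≡ true) (basis-spans (skip c x) y) (lincomb-∈ sub (lookup y) (basis (skip c x)) basis∈)

    -- Scaling by the inverse of d would put e_1 itself into W.
    e₁∈ : ∀ d → ¬ (d ≡ 0#) → ¬ (W (d ∷ zeroV) ≡ true)
    e₁∈ d d≢0 ∈W with inverse d d≢0
    ... | d⁻¹ , dd⁻¹≡1 with trans (sym e₁) (subst (λ w → W w ≡ true)
          (cong₂ _∷_ (trans (*-comm d⁻¹ d) dd⁻¹≡1) (⊙-zeroʳ d⁻¹)) (scale d⁻¹ _ ∈W))
    ...   | ()

    complete : ∀ a v → W (a ∷ v) ≡ true → mem (skip c x) (a ∷ v) ≡ true
    complete a v ∈W with trans (sym (W≈x v)) (tails-intro W a v ∈W)
    ... | v∈x with a Fin.≟ dot c (coords x v)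
    ...   | yes _   = v∈x
    -- Members a ∷ v and b ∷ v differ by (a-b) e_1, a nonzero multiple of e_1 in W.
    ...   | no  a≢b = ⊥-elim (e₁∈ (a + ((- 1#) * b)) (a≢b ∘ sub-zero⇒≡ a b) (subst (λ w → W w ≡ true)
              (cong ((a + ((- 1#) * b)) ∷_) (⊕-inverseʳ v))
              (plus _ _ ∈W (scale (- 1#) (b ∷ v) (subst (λ w → W (b ∷ w) ≡ true) (param-coords x v v∈x) (sound (coords x v)))))))
      where
      b : Fin q
      b = dot c (coords x v)

  -- The flag A₀ ⊂ A₁ ⊂ …

  -- names the characteristic function local to the definition of A
  lowOrZero : ∀ {n} → ℕ → Vec (Fin q) n → Fin n → Bool
  lowOrZero j v = conjuncts _ (refl {x = A j v})
    where
    conjuncts : ∀ {n b} (f : Fin n → Bool) → b ≡ Vec.foldr _ _∧_ true (tabulate f) → Fin n → Bool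
    conjuncts f _ = f

  A-elim : ∀ {n} j (v : Vec (Fin q) n) → A j v ≡ true → ∀ k → j ≤ toℕ k → lookup v k ≡ 0#
  A-elim j v v∈ k j≤k with toℕ k ℕ.<? j | foldr-∧-elim (lowOrZero j v) v∈ k
  ... | yes k<j | _ = ⊥-elim (ℕₚ.<-irrefl refl (ℕₚ.<-≤-trans k<j j≤k))
  ... | no  _   | h with lookup v k Fin.≟ 0#
  ...   | yes z = z

  A-intro : ∀ {n} j (v : Vec (Fin q) n) → (∀ k → j ≤ toℕ k → lookup v k ≡ 0#) → A j v ≡ true
  A-intro j v z = foldr-∧-intro (lowOrZero j v) pointwise
    where
    pointwise : ∀ k → lowOrZero j v k ≡ true
    pointwise k with toℕ k ℕ.<? j
    ... | yes _ = refl
    ... | no k≮j with lookup v k Fin.≟ 0#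
    ...   | yes _   = refl
    ...   | no ≢0   = ⊥-elim (≢0 (z k (ℕₚ.≮⇒≥ k≮j)))

  A-∷ : ∀ {n} j a (v : Vec (Fin q) n) → A (suc j) (a ∷ v) ≡ A j v
  A-∷ j a v = bool-ext
    (λ v∈ → A-intro j v (λ k j≤k → A-elim (suc j) (a ∷ v) v∈ (Fin.suc k) (s≤s j≤k)))
    (λ v∈ → A-intro (suc j) (a ∷ v) λ { (Fin.suc k) (s≤s j≤k) → A-elim j v v∈ k j≤k })

  A-zero : ∀ {n} (v : Vec (Fin q) n) → A 0 v ≡ true → v ≡ zeroV
  A-zero v v∈ = lookup-injective v zeroV (λ k → trans (A-elim 0 v v∈ k z≤n) (sym (Vecₚ.lookup-replicate k 0#)))

  lookup-⊕ : ∀ {n} (v w : Vec (Fin q) n) k → lookup (v ⊕ w) k ≡ lookup v k + lookup w k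
  lookup-⊕ v w k = Vecₚ.lookup-zipWith _+_ k v w

  A-subspace : ∀ {n} j → IsSubspace (A {n} j)
  A-subspace {n} j = A-intro j (zeroV {n}) (λ k _ → Vecₚ.lookup-replicate k 0#)
    , (λ v w v∈ w∈ → A-intro j (v ⊕ w) λ k j≤k → trans (lookup-⊕ v w k)
        (trans (cong₂ _+_ (A-elim j v v∈ k j≤k) (A-elim j w w∈ k j≤k)) (+-identityʳ 0#)))
    , (λ c v v∈ → A-intro j (c ⊙ v) λ k j≤k → trans (Vecₚ.lookup-map k (c *_) v)
        (trans (cong (c *_) (A-elim j v v∈ k j≤k)) (zeroʳ c)))

  ∩-subspace : ∀ {n} {U W : Subset n} → IsSubspace U → IsSubspace W → IsSubspace (U ∩ W)
  ∩-subspace {n} {U} {W} (z , p , s) (z′ , p′ , s′) = ∧-intro z z′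
    , (λ v w v∈ w∈ → ∧-intro (p v w (∧-elimˡ v∈) (∧-elimˡ w∈)) (p′ v w (∧-elimʳ {U v} v∈) (∧-elimʳ {U w} w∈)))
    , (λ c v v∈ → ∧-intro (s c v (∧-elimˡ v∈)) (s′ c v (∧-elimʳ {U v} v∈)))

  rank-trivial : ∀ {n} (U : Subset n) → (∀ v → U v ≡ true → v ≡ zeroV) → rank U ≡ 0
  rank-trivial {zero}  U z = refl
  rank-trivial {suc n} U z with U (1# ∷ zeroV) in e₁
  ... | true  = ⊥-elim (0≢1 (sym (Vecₚ.∷-injectiveˡ (z _ e₁))))
  ... | false = rank-trivial (tails U) λ v v∈ → let a , p = tails-elim U v v∈ in Vecₚ.∷-injectiveʳ (z _ p)

  -- Deleting the first coordinate turns `A (suc j)` into `A j`, and e_1 lies in `A (suc j)`; so the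
  -- intersection jumps at the first coordinate exactly when x does.
  rank-∩A : ∀ {n e} (x : Echelon q n e) j → rank (mem x ∩ A j) ≡ jumps x j
  rank-∩A x zero = rank-trivial (mem x ∩ A 0) (λ v v∈ → A-zero v (∧-elimʳ {mem x v} v∈))
  rank-∩A nil        (suc j) = refl
  rank-∩A {suc n} (jump x) (suc j) = trans
    (rank-jump (mem (jump x) ∩ A (suc j))
      (∧-intro (proj₁ (mem-subspace x)) (trans (A-∷ j 1# (zeroV {n})) (proj₁ (A-subspace {n} j)))))
    (cong suc (trans (rank-cong _ (mem x ∩ A j) same) (rank-∩A x j)))
    where
    same : tails (mem (jump x) ∩ A (suc j)) ≈S (mem x ∩ A j)
    same v = bool-ext
      (λ v∈ → let a , p = tails-elim (mem (jump x) ∩ A (suc j)) v v∈ in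
        ∧-intro (∧-elimˡ p) (trans (sym (A-∷ j a v)) (∧-elimʳ {mem x v} p)))
      (λ v∈ → tails-intro (mem (jump x) ∩ A (suc j)) 0# v
        (∧-intro (∧-elimˡ v∈) (trans (A-∷ j 0# v) (∧-elimʳ {mem x v} v∈))))
  rank-∩A (skip c x) (suc j) = trans
    (rank-skip (mem (skip c x) ∩ A (suc j)) (λ e₁ → 0≢1 (sym (trans
      (true-⌊⌋ (_ Fin.≟ _) (∧-elimˡ (∧-elimˡ e₁)))
      (trans (cong (dot c) (coords-zero x)) (dot-zero c))))))
    (trans (rank-cong _ (mem x ∩ A j) same) (rank-∩A x j))
    where
    same : tails (mem (skip c x) ∩ A (suc j)) ≈S (mem x ∩ A j)
    same v = bool-ext
      (λ v∈ → let a , p = tails-elim (mem (skip c x) ∩ A (suc j)) v v∈ in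
        ∧-intro (∧-elimʳ {⌊ a Fin.≟ dot c (coords x v) ⌋} (∧-elimˡ p)) (trans (sym (A-∷ j a v)) (∧-elimʳ {mem (skip c x) (a ∷ v)} p)))
      (λ v∈ → tails-intro (mem (skip c x) ∩ A (suc j)) (dot c (coords x v)) v
        (∧-intro (∧-intro (⌊⌋-true (dot c (coords x v) Fin.≟ _) refl) (∧-elimˡ v∈)) (trans (A-∷ j _ v) (∧-elimʳ {mem x v} v∈))))

  ∩A-≈ : ∀ {n e} {W : Subset n} (x : Echelon q n e) j → W ≈S mem x → (W ∩ A j) ≈S (mem x ∩ A j)
  ∩A-≈ x j W≈x v = cong (_∧ A j v) (W≈x v)

  -- With the size `jumps x j` in the type, `dim-unique` can compare any basis of the intersection
  -- with it.
  echelon-∩A : ∀ {n e} {W : Subset n} (x : Echelon q n e) j → W ≈S mem x →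
    Σ (Echelon q n (jumps x j)) λ y → (W ∩ A j) ≈S mem y
  echelon-∩A {n} x j W≈x =
    let y , ∩≈y = echelonOf (mem x ∩ A j) (∩-subspace (mem-subspace x) (A-subspace j))
    in subst (λ r → Σ (Echelon q n r) λ y → _ ≈S mem y) (rank-∩A x j)
         (y , λ v → trans (∩A-≈ x j W≈x v) (∩≈y v))

  dimGE⇒≤jumps : ∀ {n e} {W : Subset n} (x : Echelon q n e) j i → W ≈S mem x → DimGE (W ∩ A j) i → i ≤ jumps x j
  dimGE⇒≤jumps x j i W≈x (d , i≤d , hasDim) =
    let y , ≈y = echelon-∩A x j W≈x in subst (i ≤_) (dim-unique y ≈y hasDim) i≤d

  ≤jumps⇒dimGE : ∀ {n e} {W : Subset n} (x : Echelon q n e) j i → W ≈S mem x → i ≤ jumps x j → DimGE (W ∩ A j) i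
  ≤jumps⇒dimGE x j i W≈x i≤ =
    let y , ≈y = echelon-∩A x j W≈x in jumps x j , i≤ , hasDim-cong (λ v → sym (≈y v)) (mem-hasDim y)

  schubert⇒echelon : ∀ {m ℓ} (α : Fin ℓ → ℕ) {W : Subset m} → InSchubert ℓ α W →
    Σ (Echelon q m ℓ) λ x → (W ≈S mem x) × (∀ i → suc (toℕ i) ≤ jumps x (α i))
  schubert⇒echelon {m} {ℓ} α {W} (sub , dim , meets) =
    let x , W≈x = echelonOf W sub
        -- The form found is indexed by `rank W`; the given basis of ℓ vectors identifies this rank
        -- with ℓ.
        x′ , W≈x′ = subst (λ r → Σ (Echelon q m r) λ y → W ≈S mem y) (sym (dim-unique x W≈x dim)) (x , W≈x)
    in x′ , W≈x′ , λ i → dimGE⇒≤jumps x′ (α i) _ W≈x′ (meets i)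

  echelon⇒schubert : ∀ {m ℓ} (α : Fin ℓ → ℕ) (x : Echelon q m ℓ) →
    (∀ i → suc (toℕ i) ≤ jumps x (α i)) → InSchubert ℓ α (mem x)
  echelon⇒schubert α x meets = mem-subspace x , mem-hasDim x , λ i → ≤jumps⇒dimGE x (α i) _ (λ _ → refl) (meets i)

-- Sums over boxes and extended sequences

sumFromTo-cong : ∀ s t {f g : ℕ → ℤ} → (∀ r → s ≤ r → r ≤ t → f r ≡ g r) → sumFromTo s t f ≡ sumFromTo s t g
sumFromTo-cong s t {f} {g} e = trans (sumFromTo≡∑ s t f)
  (trans (∑-cong (suc t ∸ s) λ k k< → e (s ℕ.+ k) (ℕₚ.m≤m+n s k) (bound s t k k<)) (sym (sumFromTo≡∑ s t g)))
  where
  bound : ∀ s t k → k < suc t ∸ s → s ℕ.+ k ≤ t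
  bound zero    t       k k<       = ℕₚ.≤-pred k<
  bound (suc s) zero    k k<       = ⊥-elim (ℕₚ.n≮0 (subst (k <_) (ℕₚ.0∸n≡0 s) k<))
  bound (suc s) (suc t) k k<       = s≤s (bound s t k k<)

sumFromTo-scale : ∀ c s t f → sumFromTo s t (λ r → c ℤ.* f r) ≡ c ℤ.* sumFromTo s t f
sumFromTo-scale c s t f = trans (sumFromTo≡∑ s t (λ r → c ℤ.* f r))
  (trans (∑-scale c (suc t ∸ s) (λ k → f (s ℕ.+ k))) (cong (ℤ._*_ c) (sym (sumFromTo≡∑ s t f))))

boxSum-cong : ∀ {u} (lo hi : Fin u → ℕ) {f g : (Fin u → ℕ) → ℤ} → (∀ σ → f σ ≡ g σ) → boxSum lo hi f ≡ boxSum lo hi g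
boxSum-cong {zero}  lo hi e = e (λ ())
boxSum-cong {suc u} lo hi e = sumFromTo-cong (lo Fin.zero) (hi Fin.zero) λ x _ _ →
  boxSum-cong (lo ∘ Fin.suc) (hi ∘ Fin.suc) (λ σ → e (x Functional.∷ σ))

boxSum-scale : ∀ {u} c (lo hi : Fin u → ℕ) (f : (Fin u → ℕ) → ℤ) →
  boxSum lo hi (λ σ → c ℤ.* f σ) ≡ c ℤ.* boxSum lo hi f
boxSum-scale {zero}  c lo hi f = refl
boxSum-scale {suc u} c lo hi f = trans
  (sumFromTo-cong (lo Fin.zero) (hi Fin.zero) λ x _ _ →
    boxSum-scale c (lo ∘ Fin.suc) (hi ∘ Fin.suc) (λ σ → f (x Functional.∷ σ)))
  (sumFromTo-scale c (lo Fin.zero) (hi Fin.zero)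
    (λ x → boxSum (lo ∘ Fin.suc) (hi ∘ Fin.suc) (λ σ → f (x Functional.∷ σ))))

prodFin-cong : ∀ {n} {f g : Fin n → ℤ} → (∀ i → f i ≡ g i) → prodFin f ≡ prodFin g
prodFin-cong {zero}  e = refl
prodFin-cong {suc n} e = cong₂ ℤ._*_ (e Fin.zero) (prodFin-cong (e ∘ Fin.suc))

-- x₀, x₁, …, x_u, top
seq : ∀ {u} → ℕ → (Fin u → ℕ) → ℕ → ℕ → ℕ
seq         x₀ x top zero    = x₀
seq {zero}  x₀ x top (suc k) = top
seq {suc u} x₀ x top (suc k) = seq (x Fin.zero) (x ∘ Fin.suc) top k

extend-< : ∀ {u} (x : Fin u → ℕ) top (i : Fin u) → extend x top (suc (toℕ i)) ≡ x i
extend-< {u} x top i with toℕ i ℕ.<? u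
... | yes i<u = cong x (Finₚ.fromℕ<-toℕ i i<u)
... | no  i≮u = ⊥-elim (i≮u (Finₚ.toℕ<n i))

extend-≥ : ∀ {u} (x : Fin u → ℕ) top k → u ≤ k → extend x top (suc k) ≡ top
extend-≥ {u} x top k u≤k with k ℕ.<? u
... | yes k<u = ⊥-elim (ℕₚ.<-irrefl refl (ℕₚ.<-≤-trans k<u u≤k))
... | no  _   = refl

extend-∷ : ∀ {u} (x : Fin (suc u) → ℕ) top k → extend x top (suc (suc k)) ≡ extend (x ∘ Fin.suc) top (suc k)
extend-∷ {u} x top k with k ℕ.<? u
... | no  k≮u = extend-≥ x top (suc k) (s≤s (ℕₚ.≮⇒≥ k≮u))
... | yes k<u = subst (λ j → extend x top (suc (suc j)) ≡ x (Fin.suc (Fin.fromℕ< k<u))) (Finₚ.toℕ-fromℕ< k<u)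
                  (extend-< x top (Fin.suc (Fin.fromℕ< k<u)))

-- `seq` peels off one entry and starts at any value, as the induction over the blocks requires;
-- `extend` starts at 0 and decides k < u at each index.
extend≡seq : ∀ {u} (x : Fin u → ℕ) top k → extend x top k ≡ seq 0 x top k
extend≡seq         x top zero          = refl
extend≡seq {zero}  x top (suc k)       = extend-≥ x top k z≤n
extend≡seq {suc u} x top (suc zero)    = extend-< x top Fin.zero
extend≡seq {suc u} x top (suc (suc k)) = trans (extend-∷ x top k) (trans (extend≡seq (x ∘ Fin.suc) top (suc k)) (tail u (x ∘ Fin.suc)))
  where
  tail : ∀ u {x₀} (y : Fin u → ℕ) → seq 0 y top (suc k) ≡ seq x₀ y top (suc k)
  tail zero    y = refl
  tail (suc u) y = refl

seq-map : ∀ {u} (f : ℕ → ℕ) x₀ (x : Fin u → ℕ) top k → f (seq x₀ x top k) ≡ seq (f x₀) (f ∘ x) (f top) k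
seq-map         f x₀ x top zero    = refl
seq-map {zero}  f x₀ x top (suc k) = refl
seq-map {suc u} f x₀ x top (suc k) = seq-map f (x Fin.zero) (x ∘ Fin.suc) top k

-- The dimension s of W ∩ A_a is followed as a grows: n steps remain, the final value has to be ℓ,
-- and ok a s tells whether the value s is allowed at a.
module DimensionWalk (q : ℕ) (2≤q : 2 ≤ q) (ℓ : ℕ) (ok : ℕ → ℕ → Bool) where
  open Gaussian q
  open GaussianQuotient q 2≤q

  -- The factor q^(a ∸ s) counts the choices that a jump adds: one new coefficient in the functional
  -- of each of the a-s earlier skips.
  H : ℕ → ℕ → ℕ → ℤ
  H zero    a s = if ok a s then (if ⌊ s ℕ.≟ ℓ ⌋ then + 1 else + 0) else + 0
  H (suc n) a s = if ok a s then H n (suc a) s ℤ.+ + (q ^ (a ∸ s)) ℤ.* H n (suc a) (suc s) else + 0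

  H-step : ∀ n a s → ok a s ≡ true → H (suc n) a s ≡ H n (suc a) s ℤ.+ + (q ^ (a ∸ s)) ℤ.* H n (suc a) (suc s)
  H-step n a s e rewrite e = refl

  H-off : ∀ n a s → ¬ (ok a s ≡ true) → H n a s ≡ + 0
  H-off zero    a s ¬e with ok a s
  ... | true  = ⊥-elim (¬e refl)
  ... | false = refl
  H-off (suc n) a s ¬e with ok a s
  ... | true  = ⊥-elim (¬e refl)
  ... | false = refl

  H-over : ∀ n a s → ℓ < s → H n a s ≡ + 0
  H-over zero a s ℓ<s with ok a s | s ℕ.≟ ℓ
  ... | false | _       = refl
  ... | true  | yes s≡ℓ = ⊥-elim (ℕₚ.<-irrefl (sym s≡ℓ) ℓ<s)
  ... | true  | no _    = refl
  H-over (suc n) a s ℓ<s with ok a s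
  ... | false = refl
  ... | true rewrite H-over n (suc a) s ℓ<s | H-over n (suc a) (suc s) (ℕₚ.m<n⇒m<1+n ℓ<s) =
    trans (ℤₚ.+-identityˡ _) (ℤₚ.*-zeroʳ (+ (q ^ (a ∸ s))))

  -- From ℓ a further jump would overshoot, so only the walk without jumps is left, and it has
  -- weight 1. This disposes of the coordinates beyond α_ℓ.
  H-full : ∀ n a → (∀ j → a ≤ j → ok j ℓ ≡ true) → H n a ℓ ≡ + 1
  H-full zero a free with ok a ℓ | free a ℕₚ.≤-refl | ℓ ℕ.≟ ℓ
  ... | true | _ | yes _   = refl
  ... | true | _ | no ℓ≢ℓ  = ⊥-elim (ℓ≢ℓ refl)
  H-full (suc n) a free = begin
    H (suc n) a ℓ
      ≡⟨ H-step n a ℓ (free a ℕₚ.≤-refl) ⟩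
    H n (suc a) ℓ ℤ.+ + (q ^ (a ∸ ℓ)) ℤ.* H n (suc a) (suc ℓ)
      ≡⟨ cong₂ (λ x y → x ℤ.+ + (q ^ (a ∸ ℓ)) ℤ.* y)
           (H-full n (suc a) (λ j a<j → free j (ℕₚ.<⇒≤ a<j))) (H-over n (suc a) (suc ℓ) ℕₚ.≤-refl) ⟩
    + 1 ℤ.+ + (q ^ (a ∸ ℓ)) ℤ.* + 0
      ≡⟨ cong (ℤ._+_ (+ 1)) (ℤₚ.*-zeroʳ (+ (q ^ (a ∸ ℓ)))) ⟩
    + 1 ∎
    where open ≡-Reasoning

  -- The number of T-dimensional subspaces of F_q^(c+k) that meet a fixed c-dimensional one in 0. It
  -- is used with c = a-s and k = b-a.
  kernel : ℕ → ℕ → ℕ → ℤ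
  kernel c k T = + (q ^ (c ℕ.* T) ℕ.* G k T)

  kernel-0 : ∀ c k → kernel c k 0 ≡ + 1
  kernel-0 c k rewrite ℕₚ.*-zeroʳ c = refl

  kernel-vanish : ∀ c k T → k < T → kernel c k T ≡ + 0
  kernel-vanish c k T k<T rewrite G-vanish k T k<T = cong +_ (ℕₚ.*-zeroʳ (q ^ (c ℕ.* T)))

  -- The form of Pascal's rule that mirrors one step of `H`: without a jump c = a-s grows by one,
  -- while a jump costs q^c and leaves c unchanged.
  kernel-suc : ∀ c k T → kernel c (suc k) (suc T) ≡ kernel (suc c) k (suc T) ℤ.+ + (q ^ c) ℤ.* kernel c k T
  kernel-suc c k T = begin
    + (q ^ (c ℕ.* suc T) ℕ.* (q ^ suc T ℕ.* G k (suc T) ℕ.+ G k T))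
      ≡⟨ cong +_ (ℕₚ.*-distribˡ-+ (q ^ (c ℕ.* suc T)) (q ^ suc T ℕ.* G k (suc T)) (G k T)) ⟩
    + (q ^ (c ℕ.* suc T) ℕ.* (q ^ suc T ℕ.* G k (suc T)) ℕ.+ q ^ (c ℕ.* suc T) ℕ.* G k T)
      ≡⟨ cong +_ (cong₂ ℕ._+_ left right) ⟩
    + (q ^ (suc c ℕ.* suc T) ℕ.* G k (suc T) ℕ.+ q ^ c ℕ.* (q ^ (c ℕ.* T) ℕ.* G k T))
      ≡⟨ ℤₚ.pos-+ (q ^ (suc c ℕ.* suc T) ℕ.* G k (suc T)) _ ⟩
    kernel (suc c) k (suc T) ℤ.+ + (q ^ c ℕ.* (q ^ (c ℕ.* T) ℕ.* G k T))
      ≡⟨ cong (ℤ._+_ (kernel (suc c) k (suc T))) (ℤₚ.pos-* (q ^ c) _) ⟩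
    kernel (suc c) k (suc T) ℤ.+ + (q ^ c) ℤ.* kernel c k T ∎
    where
    open ≡-Reasoning
    left : q ^ (c ℕ.* suc T) ℕ.* (q ^ suc T ℕ.* G k (suc T)) ≡ q ^ (suc c ℕ.* suc T) ℕ.* G k (suc T)
    left = trans (sym (ℕₚ.*-assoc (q ^ (c ℕ.* suc T)) _ _)) (cong (ℕ._* G k (suc T))
      (trans (sym (ℕₚ.^-distribˡ-+-* q (c ℕ.* suc T) (suc T))) (cong (q ^_) (ℕₚ.+-comm (c ℕ.* suc T) (suc T)))))
    right : q ^ (c ℕ.* suc T) ℕ.* G k T ≡ q ^ c ℕ.* (q ^ (c ℕ.* T) ℕ.* G k T)
    right = trans (cong (ℕ._* G k T) (trans (cong (q ^_) (ℕₚ.*-suc c T)) (ℕₚ.^-distribˡ-+-* q c (c ℕ.* T))))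
      (ℕₚ.*-assoc (q ^ c) _ _)

  -- The end a+k may be constrained, because `H n` tests it on the right-hand side. For k = 0 the
  -- start is that end, hence the premise 0 < k.
  H-block : ∀ k n a s → s ≤ a → (0 < k → ok a s ≡ true) →
    (∀ j d → a < j → j < a ℕ.+ k → ok j d ≡ true) →
    H (k ℕ.+ n) a s ≡ ∑ (suc k) (λ T → kernel (a ∸ s) k T ℤ.* H n (a ℕ.+ k) (s ℕ.+ T))
  H-block zero n a s s≤a _ _ = sym (begin
    kernel (a ∸ s) 0 0 ℤ.* H n (a ℕ.+ 0) (s ℕ.+ 0) ℤ.+ + 0
      ≡⟨ ℤₚ.+-identityʳ (kernel (a ∸ s) 0 0 ℤ.* H n (a ℕ.+ 0) (s ℕ.+ 0)) ⟩
    kernel (a ∸ s) 0 0 ℤ.* H n (a ℕ.+ 0) (s ℕ.+ 0)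
      ≡⟨ cong₂ ℤ._*_ (kernel-0 (a ∸ s) 0) (cong₂ (H n) (ℕₚ.+-identityʳ a) (ℕₚ.+-identityʳ s)) ⟩
    + 1 ℤ.* H n a s
      ≡⟨ ℤₚ.*-identityˡ (H n a s) ⟩
    H n a s ∎)
    where open ≡-Reasoning
  H-block (suc k) n a s s≤a start free = begin
    H (suc k ℕ.+ n) a s
      ≡⟨ H-step (k ℕ.+ n) a s (start (s≤s z≤n)) ⟩
    H (k ℕ.+ n) (suc a) s ℤ.+ + (q ^ c) ℤ.* H (k ℕ.+ n) (suc a) (suc s)
      ≡⟨ cong₂ (λ x y → x ℤ.+ + (q ^ c) ℤ.* y)
           (trans (H-block k n (suc a) s (ℕₚ.m≤n⇒m≤1+n s≤a) (start′ s) free′) stay)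
           (trans (H-block k n (suc a) (suc s) (s≤s s≤a) (start′ (suc s)) free′) move) ⟩
    ∑ (suc (suc k)) (λ T → kernel (suc c) k T ℤ.* h T) ℤ.+ + (q ^ c) ℤ.* ∑ (suc k) (λ T → kernel c k T ℤ.* h (suc T))
      ≡⟨ cong (ℤ._+_ (∑ (suc (suc k)) (λ T → kernel (suc c) k T ℤ.* h T))) (∑-scale (+ (q ^ c)) (suc k) (λ T → kernel c k T ℤ.* h (suc T))) ⟨
    ∑ (suc (suc k)) (λ T → kernel (suc c) k T ℤ.* h T) ℤ.+ ∑ (suc k) (λ T → + (q ^ c) ℤ.* (kernel c k T ℤ.* h (suc T)))
      -- With the summand T = 0 set aside, both sums involve `h (suc T)` over the same range and can
      -- be added termwise.
      ≡⟨ ℤₚ.+-assoc (kernel (suc c) k 0 ℤ.* h 0) _ _ ⟩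
    kernel (suc c) k 0 ℤ.* h 0 ℤ.+ (∑ (suc k) (λ T → kernel (suc c) k (suc T) ℤ.* h (suc T))
      ℤ.+ ∑ (suc k) (λ T → + (q ^ c) ℤ.* (kernel c k T ℤ.* h (suc T))))
      ≡⟨ cong₂ ℤ._+_ (cong (ℤ._* h 0) (trans (kernel-0 (suc c) k) (sym (kernel-0 c (suc k)))))
           (trans (sym (∑-+ (suc k) (λ T → kernel (suc c) k (suc T) ℤ.* h (suc T)) (λ T → + (q ^ c) ℤ.* (kernel c k T ℤ.* h (suc T)))))
             (∑-cong (suc k) (λ T _ → pascal T))) ⟩
    ∑ (suc (suc k)) (λ T → kernel c (suc k) T ℤ.* h T) ∎
    where
    open ≡-Reasoning
    c : ℕ
    c = a ∸ s
    h : ℕ → ℤ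
    h T = H n (a ℕ.+ suc k) (s ℕ.+ T)
    start′ : ∀ d → 0 < k → ok (suc a) d ≡ true
    start′ d 0<k = free (suc a) d ℕₚ.≤-refl (subst (_< a ℕ.+ suc k) (ℕₚ.+-comm a 1) (ℕₚ.+-monoʳ-< a (s≤s 0<k)))
    free′ : ∀ j d → suc a < j → j < suc a ℕ.+ k → ok j d ≡ true
    free′ j d a<j j< = free j d (ℕₚ.<⇒≤ a<j) (subst (j <_) (sym (ℕₚ.+-suc a k)) j<)
    -- A summand at T = k+1, where the kernel is 0, extends the sum to the range of the result.
    stay : ∑ (suc k) (λ T → kernel (suc a ∸ s) k T ℤ.* H n (suc a ℕ.+ k) (s ℕ.+ T)) ≡ ∑ (suc (suc k)) (λ T → kernel (suc c) k T ℤ.* h T)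
    stay rewrite ℕₚ.+-∸-assoc 1 s≤a | sym (ℕₚ.+-suc a k) = begin
      ∑ (suc k) (λ T → kernel (suc c) k T ℤ.* h T)
        ≡⟨ ℤₚ.+-identityʳ _ ⟨
      ∑ (suc k) (λ T → kernel (suc c) k T ℤ.* h T) ℤ.+ + 0
        ≡⟨ cong (ℤ._+_ (∑ (suc k) (λ T → kernel (suc c) k T ℤ.* h T))) (trans (cong (ℤ._* h (suc k)) (kernel-vanish (suc c) k (suc k) ℕₚ.≤-refl)) (ℤₚ.*-zeroˡ (h (suc k)))) ⟨
      ∑ (suc k) (λ T → kernel (suc c) k T ℤ.* h T) ℤ.+ kernel (suc c) k (suc k) ℤ.* h (suc k)
        ≡⟨ ∑-last (suc k) (λ T → kernel (suc c) k T ℤ.* h T) ⟨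
      ∑ (suc (suc k)) (λ T → kernel (suc c) k T ℤ.* h T) ∎
    move : ∑ (suc k) (λ T → kernel (suc a ∸ suc s) k T ℤ.* H n (suc a ℕ.+ k) (suc s ℕ.+ T)) ≡ ∑ (suc k) (λ T → kernel c k T ℤ.* h (suc T))
    move = ∑-cong (suc k) (λ T _ → cong (ℤ._*_ (kernel c k T)) (cong₂ (H n) (sym (ℕₚ.+-suc a k)) (sym (ℕₚ.+-suc s T))))
    pascal : ∀ T → kernel (suc c) k (suc T) ℤ.* h (suc T) ℤ.+ + (q ^ c) ℤ.* (kernel c k T ℤ.* h (suc T)) ≡ kernel c (suc k) (suc T) ℤ.* h (suc T)
    pascal T = trans (factor (kernel (suc c) k (suc T)) (+ (q ^ c)) (kernel c k T) (h (suc T)))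
      (cong (ℤ._* h (suc T)) (sym (kernel-suc c k T)))
      where
      factor : ∀ x a y z → x ℤ.* z ℤ.+ a ℤ.* (y ℤ.* z) ≡ (x ℤ.+ a ℤ.* y) ℤ.* z
      factor = ℤ-Solver.solve-∀

  -- The sum is padded by zeros on both sides: above s+k the kernel vanishes, below s the sum λ is
  -- empty. The new range 0..b no longer depends on s, as a box sum demands.
  ∑-kernel : ∀ s c k (f : ℕ → ℤ) →
    ∑ (suc k) (λ T → kernel c k T ℤ.* f (s ℕ.+ T))
      ≡ ∑ (suc (s ℕ.+ (c ℕ.+ k))) (λ t → lam q (s ℕ.+ c) (s ℕ.+ (c ℕ.+ k)) s t ℤ.* f t)
  ∑-kernel s c k f = begin
    ∑ (suc k) (λ T → kernel c k T ℤ.* f (s ℕ.+ T))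
      ≡⟨ ∑-extend (suc k) c _ (λ T k<T _ →
           trans (cong (ℤ._* f (s ℕ.+ T)) (kernel-vanish c k T k<T)) (ℤₚ.*-zeroˡ (f (s ℕ.+ T)))) ⟨
    ∑ (suc k ℕ.+ c) (λ T → kernel c k T ℤ.* f (s ℕ.+ T))
      ≡⟨ cong (λ K → ∑ K (λ T → kernel c k T ℤ.* f (s ℕ.+ T))) (cong suc (ℕₚ.+-comm k c)) ⟩
    ∑ (suc (c ℕ.+ k)) (λ T → kernel c k T ℤ.* f (s ℕ.+ T))
      ≡⟨ ∑-cong (suc (c ℕ.+ k)) (λ { T (s≤s T≤) → cong (ℤ._* f (s ℕ.+ T)) (sym (lam-closed s c k T T≤)) }) ⟩
    ∑ (suc (c ℕ.+ k)) (λ T → lam q (s ℕ.+ c) (s ℕ.+ (c ℕ.+ k)) s (s ℕ.+ T) ℤ.* f (s ℕ.+ T))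
      ≡⟨ cong (λ K → ∑ K (λ T → lam q (s ℕ.+ c) (s ℕ.+ (c ℕ.+ k)) s (s ℕ.+ T) ℤ.* f (s ℕ.+ T)))
           (trans (cong (_∸ s) (sym (ℕₚ.+-suc s (c ℕ.+ k)))) (ℕₚ.m+n∸m≡n s (suc (c ℕ.+ k)))) ⟨
    ∑ (suc (s ℕ.+ (c ℕ.+ k)) ∸ s) (λ T → lam q (s ℕ.+ c) (s ℕ.+ (c ℕ.+ k)) s (s ℕ.+ T) ℤ.* f (s ℕ.+ T))
      ≡⟨ ∑-drop s (suc (s ℕ.+ (c ℕ.+ k))) (λ t → lam q (s ℕ.+ c) (s ℕ.+ (c ℕ.+ k)) s t ℤ.* f t)
           (λ t t<s → trans (cong (ℤ._* f t) (lam-empty (s ℕ.+ c) (s ℕ.+ (c ℕ.+ k)) s t t<s)) (ℤₚ.*-zeroˡ (f t))) ⟨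
    ∑ (suc (s ℕ.+ (c ℕ.+ k))) (λ t → lam q (s ℕ.+ c) (s ℕ.+ (c ℕ.+ k)) s t ℤ.* f t) ∎
    where open ≡-Reasoning

  -- Both limits depend on the checkpoint alone: `ok` removes the values below p, and dimensions up
  -- to b that cannot be reached from s carry the factor λ = 0.
  H-checkpoint : ∀ n a b s p → s ≤ a → a < b → b ≤ a ℕ.+ n → ok a s ≡ true →
    (∀ j d → a < j → j < b → ok j d ≡ true) →
    (∀ d → ok b d ≡ true → p ≤ d) →
    H n a s ≡ sumFromTo p b (λ t → lam q a b s t ℤ.* H (n ∸ (b ∸ a)) b t)
  H-checkpoint n a b s p s≤a a<b b≤a+n start free bound = begin
    H n a s
      ≡⟨ cong (λ z → H z a s) (ℕₚ.m+[n∸m]≡n k≤n) ⟨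
    H (k ℕ.+ n′) a s
      ≡⟨ H-block k n′ a s s≤a (λ _ → start) (λ j d a<j j< → free j d a<j (subst (j <_) a+k≡b j<)) ⟩
    ∑ (suc k) (λ T → kernel c k T ℤ.* H n′ (a ℕ.+ k) (s ℕ.+ T))
      ≡⟨ cong (λ z → ∑ (suc k) (λ T → kernel c k T ℤ.* H n′ z (s ℕ.+ T))) a+k≡b ⟩
    ∑ (suc k) (λ T → kernel c k T ℤ.* H n′ b (s ℕ.+ T))
      ≡⟨ ∑-kernel s c k (H n′ b) ⟩
    ∑ (suc (s ℕ.+ (c ℕ.+ k))) (λ t → lam q (s ℕ.+ c) (s ℕ.+ (c ℕ.+ k)) s t ℤ.* H n′ b t)
      ≡⟨ cong₂ (λ x y → ∑ (suc y) (λ t → lam q x y s t ℤ.* H n′ b t)) s+c≡a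
           (trans (sym (ℕₚ.+-assoc s c k)) (trans (cong (ℕ._+ k) s+c≡a) a+k≡b)) ⟩
    ∑ (suc b) (λ t → lam q a b s t ℤ.* H n′ b t)
      ≡⟨ ∑-drop p (suc b) (λ t → lam q a b s t ℤ.* H n′ b t) (λ t t<p →
           trans (cong (ℤ._*_ (lam q a b s t)) (H-off n′ b t (λ e → ℕₚ.<-irrefl refl (ℕₚ.<-≤-trans t<p (bound t e)))))
             (ℤₚ.*-zeroʳ (lam q a b s t))) ⟩
    ∑ (suc b ∸ p) (λ r → lam q a b s (p ℕ.+ r) ℤ.* H n′ b (p ℕ.+ r))
      ≡⟨ sumFromTo≡∑ p b (λ t → lam q a b s t ℤ.* H n′ b t) ⟨
    sumFromTo p b (λ t → lam q a b s t ℤ.* H n′ b t) ∎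
    where
    open ≡-Reasoning
    k n′ c : ℕ
    k = b ∸ a
    n′ = n ∸ k
    c = a ∸ s
    a+k≡b : a ℕ.+ k ≡ b
    a+k≡b = ℕₚ.m+[n∸m]≡n (ℕₚ.<⇒≤ a<b)
    s+c≡a : s ℕ.+ c ≡ a
    s+c≡a = ℕₚ.m+[n∸m]≡n s≤a
    k≤n : k ≤ n
    k≤n = ℕₚ.m≤n+o⇒m∸n≤o b a b≤a+n

  -- What has to hold at and between the block ends ahead of a. At an inner end the bound `lo` is
  -- both the lower limit of summation and enough to walk on. The last end is separate: the walk
  -- must be at ℓ there, and ℓ must stay allowed afterwards.
  data Checkpoints (m top : ℕ) : ∀ {u} → ℕ → (A lo : Fin u → ℕ) → Set where
    last : ∀ {a} {A lo : Fin 0 → ℕ} → a < top → top ≤ m → ℓ ≤ top →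
      (∀ j d → a < j → j < top → ok j d ≡ true) →
      (∀ d → ok top d ≡ true → ℓ ≤ d) →
      (∀ j → top ≤ j → ok j ℓ ≡ true) →
      Checkpoints m top a A lo
    next : ∀ {u a} {A lo : Fin (suc u) → ℕ} → a < A Fin.zero → A Fin.zero ≤ m →
      (∀ j d → a < j → j < A Fin.zero → ok j d ≡ true) →
      (∀ d → ok (A Fin.zero) d ≡ true → lo Fin.zero ≤ d) →
      (∀ d → lo Fin.zero ≤ d → ok (A Fin.zero) d ≡ true) →
      Checkpoints m top (A Fin.zero) (A ∘ Fin.suc) (lo ∘ Fin.suc) →
      Checkpoints m top a A lo

  blockProduct : ∀ {u} → ℕ → ℕ → (A σ : Fin u → ℕ) → ℕ → ℤ
  blockProduct {u} a s A σ top = prodFin {suc u} λ i →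
    lam q (seq a A top (toℕ i)) (seq a A top (suc (toℕ i))) (seq s σ ℓ (toℕ i)) (seq s σ ℓ (suc (toℕ i)))

  H≡boxSum : ∀ {u m top} n a s (A lo : Fin u → ℕ) → m ≡ a ℕ.+ n → s ≤ a → ok a s ≡ true →
    Checkpoints m top a A lo → H n a s ≡ boxSum lo A (λ σ → blockProduct a s A σ top)
  H≡boxSum {top = top} n a s A lo refl s≤a start (last a<top top≤m ℓ≤top free bound full) = begin
    H n a s
      ≡⟨ H-checkpoint n a top s ℓ s≤a a<top top≤m start free bound ⟩
    sumFromTo ℓ top f
      ≡⟨ sumFromTo≡∑ ℓ top f ⟩
    ∑ (suc top ∸ ℓ) (λ k → f (ℓ ℕ.+ k))
      ≡⟨ cong (λ K → ∑ K (λ k → f (ℓ ℕ.+ k))) (ℕₚ.+-∸-assoc 1 ℓ≤top) ⟩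
    f (ℓ ℕ.+ 0) ℤ.+ ∑ (top ∸ ℓ) (λ k → f (ℓ ℕ.+ suc k))
      -- Only t = ℓ survives: the lower limit excludes smaller values, `H-over` removes larger ones.
      ≡⟨ cong₂ ℤ._+_ (cong f (ℕₚ.+-identityʳ ℓ)) (∑-zero (top ∸ ℓ) _ vanish) ⟩
    f ℓ ℤ.+ + 0
      ≡⟨ ℤₚ.+-identityʳ (f ℓ) ⟩
    f ℓ
      ≡⟨ cong (ℤ._*_ (lam q a top s ℓ)) (H-full n′ top full) ⟩
    lam q a top s ℓ ℤ.* + 1 ∎
    where
    open ≡-Reasoning
    n′ : ℕ
    n′ = n ∸ (top ∸ a)
    f : ℕ → ℤ
    f t = lam q a top s t ℤ.* H n′ top t
    vanish : ∀ k → k < top ∸ ℓ → f (ℓ ℕ.+ suc k) ≡ + 0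
    vanish k _ = trans (cong (ℤ._*_ (lam q a top s (ℓ ℕ.+ suc k))) (H-over n′ top (ℓ ℕ.+ suc k) (ℕₚ.m<m+n ℓ (s≤s z≤n))))
      (ℤₚ.*-zeroʳ (lam q a top s (ℓ ℕ.+ suc k)))
  H≡boxSum {top = top} n a s A lo refl s≤a start (next a<b b≤m free bound enough rest) = trans
    (H-checkpoint n a b s (lo Fin.zero) s≤a a<b b≤m start free bound)
    (sumFromTo-cong (lo Fin.zero) b λ t lo≤t t≤b → trans
      (cong (ℤ._*_ (lam q a b s t))
        (H≡boxSum (n ∸ (b ∸ a)) b t (A ∘ Fin.suc) (lo ∘ Fin.suc) total t≤b (enough t lo≤t) rest))
      (sym (boxSum-scale (lam q a b s t) (lo ∘ Fin.suc) (A ∘ Fin.suc) (λ σ → blockProduct b t (A ∘ Fin.suc) σ top))))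
    where
    b : ℕ
    b = A Fin.zero
    total : a ℕ.+ n ≡ b ℕ.+ (n ∸ (b ∸ a))
    total = begin
      a ℕ.+ n                             ≡⟨ cong (a ℕ.+_) (ℕₚ.m+[n∸m]≡n (ℕₚ.m≤n+o⇒m∸n≤o b a b≤m)) ⟨
      a ℕ.+ ((b ∸ a) ℕ.+ (n ∸ (b ∸ a)))   ≡⟨ ℕₚ.+-assoc a (b ∸ a) _ ⟨
      (a ℕ.+ (b ∸ a)) ℕ.+ (n ∸ (b ∸ a))   ≡⟨ cong (ℕ._+ (n ∸ (b ∸ a))) (ℕₚ.m+[n∸m]≡n (ℕₚ.<⇒≤ a<b)) ⟩
      b ℕ.+ (n ∸ (b ∸ a)) ∎
      where open ≡-Reasoning

-- Enumerating echelon forms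

length-cartesianProductWith : ∀ {A B C : Set} (f : A → B → C) xs ys →
  length (cartesianProductWith f xs ys) ≡ length xs ℕ.* length ys
length-cartesianProductWith f List.[]       ys = refl
length-cartesianProductWith f (x List.∷ xs) ys = trans (Listₚ.length-++ (List.map (f x) ys))
  (cong₂ ℕ._+_ (Listₚ.length-map (f x) ys) (length-cartesianProductWith f xs ys))

unique-lookup : ∀ {A : Set} {xs : List A} → Unique xs → ∀ i j → List.lookup xs i ≡ List.lookup xs j → i ≡ j
unique-lookup (x∉ ∷ u) Fin.zero    Fin.zero    _ = refl
unique-lookup (x∉ ∷ u) Fin.zero    (Fin.suc j) e = ⊥-elim (All.lookup x∉ (∈ₚ.∈-lookup j) e)
unique-lookup (x∉ ∷ u) (Fin.suc i) Fin.zero    e = ⊥-elim (All.lookup x∉ (∈ₚ.∈-lookup i) (sym e))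
unique-lookup (x∉ ∷ u) (Fin.suc i) (Fin.suc j) e = cong Fin.suc (unique-lookup u i j e)

vectors : ∀ q e → List (Vec (Fin q) e)
vectors q zero    = List.[ [] ]
vectors q (suc e) = cartesianProductWith _∷_ (allFin q) (vectors q e)

length-vectors : ∀ q e → length (vectors q e) ≡ q ^ e
length-vectors q zero    = refl
length-vectors q (suc e) = trans (length-cartesianProductWith _∷_ (allFin q) (vectors q e))
  (cong₂ ℕ._*_ (Listₚ.length-tabulate {n = q} id) (length-vectors q e))

∈-vectors : ∀ {q e} (v : Vec (Fin q) e) → v ∈ vectors q e
∈-vectors []      = here refl
∈-vectors (a ∷ v) = ∈ₚ.∈-cartesianProductWith⁺ _∷_ (∈ₚ.∈-allFin a) (∈-vectors v)

vectors-unique : ∀ q e → Unique (vectors q e)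
vectors-unique q zero    = All.[] ∷ []
vectors-unique q (suc e) = Uniqueₚ.cartesianProductWith⁺ _∷_ Vecₚ.∷-injective (Uniqueₚ.allFin⁺ q) (vectors-unique q e)

skip-injective : ∀ {q n e} {c c′ : Vec (Fin q) e} {x y : Echelon q n e} → skip c x ≡ skip c′ y → c ≡ c′ × x ≡ y
skip-injective refl = refl , refl

jump-injective : ∀ {q n e} {x y : Echelon q n e} → jump x ≡ jump y → x ≡ y
jump-injective refl = refl

module Enumeration (q : ℕ) (ok : ℕ → ℕ → Bool) where

  mutual
    -- Testing `ok` at every node makes the lengths obey the recursion of `H` up to the placement of
    -- the powers of q.
    echelons : ∀ n e → ℕ → ℕ → List (Echelon q n e)
    echelons n e a s = if ok a s then branches n e a s else List.[]

    branches : ∀ n e → ℕ → ℕ → List (Echelon q n e)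
    branches zero    zero    a s = List.[ nil ]
    branches zero    (suc e) a s = List.[]
    branches (suc n) e       a s = jumping n e a s List.++ cartesianProductWith skip (vectors q e) (echelons n e (suc a) s)

    jumping : ∀ n e → ℕ → ℕ → List (Echelon q (suc n) e)
    jumping n zero    a s = List.[]
    jumping n (suc e) a s = List.map jump (echelons n e (suc a) (suc s))

  Admissible : ∀ {n e} → Echelon q n e → ℕ → ℕ → Set
  Admissible {n} x a s = ∀ j → j ≤ n → ok (a ℕ.+ j) (s ℕ.+ jumps x j) ≡ true

  ∈-echelons : ∀ {n e} (x : Echelon q n e) a s → Admissible x a s → x ∈ echelons n e a s
  ∈-echelons {n} {e} x a s adm
    rewrite trans (cong₂ ok (sym (ℕₚ.+-identityʳ a)) (sym (ℕₚ.+-identityʳ s))) (adm 0 z≤n) = branch x adm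
    where
    branch : ∀ {n e} (x : Echelon q n e) → Admissible x a s → x ∈ branches n e a s
    branch nil        _   = here refl
    branch {suc n} (jump x)   adm = ∈ₚ.∈-++⁺ˡ (∈ₚ.∈-map⁺ jump (∈-echelons x (suc a) (suc s) λ j j≤n →
      subst₂ (λ b d → ok b d ≡ true) (ℕₚ.+-suc a j) (ℕₚ.+-suc s (jumps x j)) (adm (suc j) (s≤s j≤n))))
    branch {suc n} {e} (skip c x) adm = ∈ₚ.∈-++⁺ʳ (jumping n e a s) (∈ₚ.∈-cartesianProductWith⁺ skip (∈-vectors c)
      (∈-echelons x (suc a) s λ j j≤n → subst (λ b → ok b (s ℕ.+ jumps x j) ≡ true) (ℕₚ.+-suc a j) (adm (suc j) (s≤s j≤n))))

  echelons-admissible : ∀ {n e} (x : Echelon q n e) a s → x ∈ echelons n e a s → Admissible x a s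
  echelons-admissible {n} {e} x a s x∈ j j≤n with ok a s in okas
  ... | false = ⊥-elim (¬∈[] x∈)
    where
    ¬∈[] : ∀ {A : Set} {x : A} → ¬ (x ∈ List.[])
    ¬∈[] ()
  echelons-admissible x a s x∈ zero j≤n | true =
    trans (cong₂ ok (ℕₚ.+-identityʳ a) (ℕₚ.+-identityʳ s)) okas
  echelons-admissible {suc n} {e} x a s x∈ (suc j) (s≤s j≤n) | true with ∈ₚ.∈-++⁻ (jumping n e a s) x∈
  echelons-admissible {suc n} {suc e} x a s x∈ (suc j) (s≤s j≤n) | true | inj₁ x∈′ with ∈ₚ.∈-map⁻ jump x∈′
  ... | y , y∈ , refl = subst₂ (λ b d → ok b d ≡ true) (sym (ℕₚ.+-suc a j)) (sym (ℕₚ.+-suc s (jumps y j)))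
                          (echelons-admissible y (suc a) (suc s) y∈ j j≤n)
  echelons-admissible {suc n} {e} x a s x∈ (suc j) (s≤s j≤n) | true | inj₂ x∈′
    with ∈ₚ.∈-cartesianProductWith⁻ skip (vectors q e) (echelons n e (suc a) s) x∈′
  ... | c , y , _ , y∈ , refl = subst (λ b → ok b (s ℕ.+ jumps y j) ≡ true) (sym (ℕₚ.+-suc a j))
                                  (echelons-admissible y (suc a) s y∈ j j≤n)

  echelons-unique : ∀ n e a s → Unique (echelons n e a s)
  echelons-unique n e a s with ok a s
  echelons-unique n       e       a s | false = []
  echelons-unique zero    zero    a s | true  = All.[] ∷ []
  echelons-unique zero    (suc e) a s | true  = []
  echelons-unique (suc n) e       a s | true  = Uniqueₚ.++⁺ (jumping-unique e)
    (Uniqueₚ.cartesianProductWith⁺ skip skip-injective (vectors-unique q e) (echelons-unique n e (suc a) s))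
    (λ { (x∈ , x∈′) → disjoint e x∈ x∈′ })
    where
    jumping-unique : ∀ e → Unique (jumping n e a s)
    jumping-unique zero    = []
    jumping-unique (suc e) = Uniqueₚ.map⁺ jump-injective (echelons-unique n e (suc a) (suc s))
    disjoint : ∀ e {x} → x ∈ jumping n e a s → ¬ (x ∈ cartesianProductWith skip (vectors q e) (echelons n e (suc a) s))
    disjoint (suc e) x∈ x∈′ with ∈ₚ.∈-map⁻ jump x∈ | ∈ₚ.∈-cartesianProductWith⁻ skip (vectors q (suc e)) (echelons n (suc e) (suc a) s) x∈′
    ... | _ , _ , refl | _ , _ , _ , _ , ()

  length-branches : ∀ n e a s →
    length (branches (suc n) e a s) ≡ length (jumping n e a s) ℕ.+ q ^ e ℕ.* length (echelons n e (suc a) s)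
  length-branches n e a s = trans (Listₚ.length-++ (jumping n e a s))
    (cong (length (jumping n e a s) ℕ.+_) (trans (length-cartesianProductWith skip (vectors q e) _)
      (cong (ℕ._* length (echelons n e (suc a) s)) (length-vectors q e))))

  -- H weights the jumps of a walk by q^(a ∸ s), the enumeration the other steps by q^e;
  -- the factor q^((a ∸ s) e) converts one into the other.
  length-echelons : ∀ 2≤q ℓ n e a s → s ≤ a → s ℕ.+ e ≡ ℓ →
    + (q ^ ((a ∸ s) ℕ.* e) ℕ.* length (echelons n e a s)) ≡ DimensionWalk.H q 2≤q ℓ ok n a s
  length-echelons 2≤q ℓ n e a s s≤a s+e≡ℓ with ok a s in okas
  length-echelons 2≤q ℓ zero e a s s≤a s+e≡ℓ | false rewrite okas = cong +_ (ℕₚ.*-zeroʳ (q ^ ((a ∸ s) ℕ.* e)))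
  length-echelons 2≤q ℓ (suc n) e a s s≤a s+e≡ℓ | false rewrite okas = cong +_ (ℕₚ.*-zeroʳ (q ^ ((a ∸ s) ℕ.* e)))
  length-echelons 2≤q ℓ zero zero a s s≤a s+e≡ℓ | true rewrite okas | ℕₚ.*-zeroʳ (a ∸ s) with s ℕ.≟ ℓ
  ... | yes _   = refl
  ... | no  s≢ℓ = ⊥-elim (s≢ℓ (trans (sym (ℕₚ.+-identityʳ s)) s+e≡ℓ))
  length-echelons 2≤q ℓ zero (suc e) a s s≤a s+e≡ℓ | true rewrite okas | ℕₚ.*-zeroʳ (q ^ ((a ∸ s) ℕ.* suc e)) with s ℕ.≟ ℓ
  ... | no  _   = refl
  ... | yes s≡ℓ = ⊥-elim (ℕₚ.m+1+n≢m s (trans s+e≡ℓ (sym s≡ℓ)))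
  length-echelons 2≤q ℓ (suc n) e a s s≤a s+e≡ℓ | true rewrite okas = begin
    + (q ^ (c ℕ.* e) ℕ.* length (branches (suc n) e a s))
      ≡⟨ cong (λ z → + (q ^ (c ℕ.* e) ℕ.* z)) (length-branches n e a s) ⟩
    + (q ^ (c ℕ.* e) ℕ.* (length (jumping n e a s) ℕ.+ q ^ e ℕ.* L))
      ≡⟨ cong +_ (trans (ℕₚ.*-distribˡ-+ (q ^ (c ℕ.* e)) _ _) (ℕₚ.+-comm (q ^ (c ℕ.* e) ℕ.* length (jumping n e a s)) _)) ⟩
    + (q ^ (c ℕ.* e) ℕ.* (q ^ e ℕ.* L) ℕ.+ q ^ (c ℕ.* e) ℕ.* length (jumping n e a s))
      ≡⟨ ℤₚ.pos-+ (q ^ (c ℕ.* e) ℕ.* (q ^ e ℕ.* L)) _ ⟩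
    + (q ^ (c ℕ.* e) ℕ.* (q ^ e ℕ.* L)) ℤ.+ + (q ^ (c ℕ.* e) ℕ.* length (jumping n e a s))
      ≡⟨ cong₂ ℤ._+_ (trans (cong +_ regroup) (length-echelons 2≤q ℓ n e (suc a) s (ℕₚ.m≤n⇒m≤1+n s≤a) s+e≡ℓ)) (jumped e s+e≡ℓ) ⟩
    H n (suc a) s ℤ.+ + (q ^ c) ℤ.* H n (suc a) (suc s) ∎
    where
    open ≡-Reasoning
    open DimensionWalk q 2≤q ℓ ok using (H; H-over)
    c L : ℕ
    c = a ∸ s
    L = length (echelons n e (suc a) s)
    -- A skip raises a-s by one, and its q^e functionals supply the change of the exponent from c e
    -- to (c+1) e.
    regroup : q ^ (c ℕ.* e) ℕ.* (q ^ e ℕ.* L) ≡ q ^ ((suc a ∸ s) ℕ.* e) ℕ.* L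
    regroup = trans (sym (ℕₚ.*-assoc (q ^ (c ℕ.* e)) (q ^ e) L)) (cong (ℕ._* L)
      (trans (sym (ℕₚ.^-distribˡ-+-* q (c ℕ.* e) e))
        (cong (q ^_) (trans (ℕₚ.+-comm (c ℕ.* e) e) (cong (ℕ._* e) (sym (ℕₚ.+-∸-assoc 1 s≤a)))))))
    -- A jump keeps c and lowers e by one, which sets free the factor q^c of `H`. For e = 0 no jump
    -- is left, and `H` is 0 beyond ℓ.
    jumped : ∀ e → s ℕ.+ e ≡ ℓ → + (q ^ (c ℕ.* e) ℕ.* length (jumping n e a s)) ≡ + (q ^ c) ℤ.* H n (suc a) (suc s)
    jumped zero    s+e≡ℓ = trans (cong +_ (ℕₚ.*-zeroʳ (q ^ (c ℕ.* 0)))) (sym (trans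
      (cong (ℤ._*_ (+ (q ^ c))) (H-over n (suc a) (suc s) (s≤s (ℕₚ.≤-reflexive (trans (sym s+e≡ℓ) (ℕₚ.+-identityʳ s))))))
      (ℤₚ.*-zeroʳ (+ (q ^ c)))))
    jumped (suc e) s+e≡ℓ = begin
      + (q ^ (c ℕ.* suc e) ℕ.* length (List.map jump (echelons n e (suc a) (suc s))))
        ≡⟨ cong +_ (cong₂ ℕ._*_ (trans (cong (q ^_) (ℕₚ.*-suc c e)) (ℕₚ.^-distribˡ-+-* q c (c ℕ.* e))) (Listₚ.length-map jump (echelons n e (suc a) (suc s)))) ⟩
      + (q ^ c ℕ.* q ^ (c ℕ.* e) ℕ.* L′)
        ≡⟨ cong +_ (ℕₚ.*-assoc (q ^ c) _ L′) ⟩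
      + (q ^ c ℕ.* (q ^ (c ℕ.* e) ℕ.* L′))
        ≡⟨ ℤₚ.pos-* (q ^ c) _ ⟩
      + (q ^ c) ℤ.* + (q ^ (c ℕ.* e) ℕ.* L′)
        ≡⟨ cong (ℤ._*_ (+ (q ^ c))) (length-echelons 2≤q ℓ n e (suc a) (suc s) (s≤s s≤a) (trans (sym (ℕₚ.+-suc s e)) s+e≡ℓ)) ⟩
      + (q ^ c) ℤ.* H n (suc a) (suc s) ∎
      where
      L′ : ℕ
      L′ = length (echelons n e (suc a) (suc s))

-- The conditions at the ends of the blocks

module BlockEnds {u : ℕ} (A lo : Fin u → ℕ) (top ℓ : ℕ) where

  -- Vacuous away from the block ends, so one test serves every position of the walk.
  Ends : ∀ {u} (A lo : Fin u → ℕ) → ℕ → ℕ → Set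
  Ends A lo j d = (∀ k → A k ≡ j → lo k ≤ d) × (top ≡ j → ℓ ≤ d)

  ends? : ∀ j d → Dec (Ends A lo j d)
  ends? j d = Finₚ.all? (λ k → (A k ℕ.≟ j) →-dec (lo k ℕ.≤? d)) ×-dec ((top ℕ.≟ j) →-dec (ℓ ℕ.≤? d))

  ok : ℕ → ℕ → Bool
  ok j d = ⌊ ends? j d ⌋

  open module Walk {q} {2≤q} = DimensionWalk q 2≤q ℓ ok using (Checkpoints; last; next)

  -- In the induction `ok` keeps referring to all block ends while B and b shrink to a tail of them.
  -- The two conversions are therefore asked only for j > a, where the ends already passed make no
  -- difference.
  checkpoints : ∀ {q 2≤q u m} a (B b : Fin u → ℕ) →
    StrictIncr B → (∀ k → a < B k) → (∀ k → B k < top) → a < top → top ≤ m → ℓ ≤ top →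
    (∀ j d → a < j → Ends B b j d → ok j d ≡ true) →
    (∀ j d → a < j → ok j d ≡ true → Ends B b j d) →
    Checkpoints {q} {2≤q} m top a B b
  checkpoints {u = zero} a B b incr a<B B<top a<top top≤m ℓ≤top to from =
    last a<top top≤m ℓ≤top
      (λ j d a<j j<top → to j d a<j ((λ ()) , λ top≡j → ⊥-elim (ℕₚ.<-irrefl (sym top≡j) j<top)))
      (λ d e → proj₂ (from top d a<top e) refl)
      (λ j top≤j → to j ℓ (ℕₚ.<-≤-trans a<top top≤j) ((λ ()) , λ _ → ℕₚ.≤-refl))
  checkpoints {u = suc u} a B b incr a<B B<top a<top top≤m ℓ≤top to from =
    next (a<B Fin.zero) (ℕₚ.≤-trans (ℕₚ.<⇒≤ (B<top Fin.zero)) top≤m)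
      (λ j d a<j j<B₀ → to j d a<j
        ( (λ k Bk≡j → ⊥-elim (ℕₚ.<-irrefl refl (ℕₚ.<-≤-trans (subst (_< B Fin.zero) (sym Bk≡j) j<B₀) (first k))))
        , (λ top≡j → ⊥-elim (ℕₚ.<-asym (B<top Fin.zero) (subst (_< B Fin.zero) (sym top≡j) j<B₀)))))
      (λ d e → proj₁ (from (B Fin.zero) d (a<B Fin.zero) e) Fin.zero refl)
      (λ d b₀≤d → to (B Fin.zero) d (a<B Fin.zero)
        ( (λ { Fin.zero    _  → b₀≤d
             ; (Fin.suc k) e  → ⊥-elim (ℕₚ.<-irrefl (sym e) (step k)) })
        , (λ top≡B₀ → ⊥-elim (ℕₚ.<-irrefl (sym top≡B₀) (B<top Fin.zero)))))
      (checkpoints (B Fin.zero) (B ∘ Fin.suc) (b ∘ Fin.suc)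
        (λ i j i<j → incr (Fin.suc i) (Fin.suc j) (s≤s i<j)) step (B<top ∘ Fin.suc) (B<top Fin.zero) top≤m ℓ≤top
        (λ j d B₀<j (ends , end) → to j d (ℕₚ.<-trans (a<B Fin.zero) B₀<j)
          ((λ { Fin.zero e → ⊥-elim (ℕₚ.<-irrefl e B₀<j) ; (Fin.suc k) → ends k }) , end))
        (λ j d B₀<j e → let ends , end = from j d (ℕₚ.<-trans (a<B Fin.zero) B₀<j) e in ends ∘ Fin.suc , end))
    where
    step : ∀ k → B Fin.zero < B (Fin.suc k)
    step k = incr Fin.zero (Fin.suc k) (s≤s z≤n)
    first : ∀ k → B Fin.zero ≤ B k
    first Fin.zero    = ℕₚ.≤-refl
    first (Fin.suc k) = ℕₚ.<⇒≤ (step k)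

module Blocked {ℓ : ℕ} (α : Fin ℓ → ℕ) (incr : StrictIncr α) (1≤α : ∀ i → 1 ≤ α i)
  {u : ℕ} (p : Fin u → ℕ) (blocks : Blocks ℓ α u p) where

  αAt-suc : ∀ i → αAt α (suc (toℕ i)) ≡ α i
  αAt-suc = extend-< α 0

  αAt-step : ∀ j → suc j ≤ ℓ → αAt α j < αAt α (suc j)
  αAt-step zero    1≤ℓ =
    subst (1 ≤_) (trans (sym (αAt-suc (Fin.fromℕ< 1≤ℓ))) (cong (αAt α ∘ suc) (Finₚ.toℕ-fromℕ< 1≤ℓ))) (1≤α (Fin.fromℕ< 1≤ℓ))
  αAt-step (suc j) j<ℓ = subst₂ _<_ (at j≤ℓ) (at j<ℓ) (incr (Fin.fromℕ< j≤ℓ) (Fin.fromℕ< j<ℓ)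
      (subst₂ _<_ (sym (Finₚ.toℕ-fromℕ< j≤ℓ)) (sym (Finₚ.toℕ-fromℕ< j<ℓ)) ℕₚ.≤-refl))
    where
    j≤ℓ : suc j ≤ ℓ
    j≤ℓ = ℕₚ.<⇒≤ j<ℓ
    at : ∀ {i} (i<ℓ : i < ℓ) → α (Fin.fromℕ< i<ℓ) ≡ αAt α (suc i)
    at i<ℓ = trans (sym (αAt-suc (Fin.fromℕ< i<ℓ))) (cong (αAt α ∘ suc) (Finₚ.toℕ-fromℕ< i<ℓ))

  αAt-< : ∀ {i j} → i < j → j ≤ ℓ → αAt α i < αAt α j
  αAt-< {i} {suc j} (s≤s i≤j) j<ℓ with ℕₚ.m≤n⇒m<n∨m≡n i≤j
  ... | inj₁ i<j  = ℕₚ.<-trans (αAt-< i<j (ℕₚ.<⇒≤ j<ℓ)) (αAt-step j j<ℓ)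
  ... | inj₂ refl = αAt-step j j<ℓ

  ≤αAt : ∀ j → j ≤ ℓ → j ≤ αAt α j
  ≤αAt zero    _   = z≤n
  ≤αAt (suc j) j<ℓ = ℕₚ.≤-<-trans (≤αAt j (ℕₚ.<⇒≤ j<ℓ)) (αAt-step j j<ℓ)

  -- Inside a block A_{α_j} has codimension 1 in A_{α_{j+1}}, so the conditions propagate downwards.
  module _ {q n e : ℕ} (x : Echelon q n e) where

    Meets : ℕ → Set
    Meets j = j ≤ jumps x (αAt α j)

    meets-ends⇒meets : (∀ k → Meets (p k)) → Meets ℓ → ∀ i → suc (toℕ i) ≤ jumps x (α i)
    meets-ends⇒meets ends end i = subst (λ a → suc (toℕ i) ≤ jumps x a) (αAt-suc i)
      (upTo-end (suc u) ℕₚ.≤-refl (suc (toℕ i)) (subst (suc (toℕ i) ≤_) (sym (extend-≥ p ℓ u ℕₚ.≤-refl)) (Finₚ.toℕ<n i)))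
      where
      at-end : ∀ i → Meets (extend p ℓ i)
      at-end zero = z≤n
      at-end (suc k) with k ℕ.<? u
      ... | yes k<u = ends (Fin.fromℕ< k<u)
      ... | no  _   = end

      -- Here t is the distance to the end of the block. The index j stays strictly behind the
      -- previous end because α may have a gap between blocks.
      descend : ∀ i → i ≤ u → ∀ t j → j ℕ.+ t ≡ extend p ℓ (suc i) → extend p ℓ i < j → Meets j
      descend i i≤u zero    j e _   = subst Meets (trans (sym e) (ℕₚ.+-identityʳ j)) (at-end (suc i))
      descend i i≤u (suc t) j e i<j = ℕₚ.≤-pred (begin
        suc j                        ≤⟨ descend i i≤u t (suc j) (trans (sym (ℕₚ.+-suc j t)) e) (ℕₚ.m<n⇒m<1+n i<j) ⟩
        jumps x (αAt α (suc j))      ≡⟨ cong (jumps x) (proj₂ (proj₂ blocks) i i≤u j i<j (subst (j <_) e (ℕₚ.m<m+n j (s≤s z≤n)))) ⟩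
        jumps x (suc (αAt α j))      ≤⟨ jumps-suc-≤ x (αAt α j) ⟩
        suc (jumps x (αAt α j)) ∎)
        where open ℕₚ.≤-Reasoning

      upTo-end : ∀ i → i ≤ suc u → ∀ j → j ≤ extend p ℓ i → Meets j
      upTo-end zero    _         zero _ = z≤n
      upTo-end (suc i) (s≤s i≤u) j j≤ with ℕₚ.≤-<-connex j (extend p ℓ i)
      ... | inj₁ j≤i = upTo-end i (ℕₚ.m≤n⇒m≤1+n i≤u) j j≤i
      ... | inj₂ i<j = descend i i≤u (extend p ℓ (suc i) ∸ j) j (ℕₚ.m+[n∸m]≡n j≤) i<j

    meets⇒meets-at : (∀ i → suc (toℕ i) ≤ jumps x (α i)) → ∀ j → 1 ≤ j → j ≤ ℓ → Meets j
    meets⇒meets-at meets (suc j) _ j<ℓ = subst (λ k → suc k ≤ jumps x (αAt α (suc k))) (Finₚ.toℕ-fromℕ< j<ℓ)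
      (subst (λ a → suc (toℕ i) ≤ jumps x a) (sym (αAt-suc i)) (meets i))
      where
      i : Fin ℓ
      i = Fin.fromℕ< j<ℓ

-- Comparison of the count with the formula

lam-cong : ∀ q {a a′ b b′ s s′ t t′} → a ≡ a′ → b ≡ b′ → s ≡ s′ → t ≡ t′ → lam q a b s t ≡ lam q a′ b′ s′ t′
lam-cong q refl refl refl refl = refl

-- Subsets are functions compared only pointwise, so the enumerations themselves cannot be equated;
-- injections between their index sets in both directions give the equality.
count≡length : ∀ {q m N} (F : FiniteField q) {P : (Vec (Fin q) m → Bool) → Set} → LinAlg.HasCount F m P N →
  ∀ {X : Set} (f : X → Vec (Fin q) m → Bool) → (∀ x y → (∀ v → f x v ≡ f y v) → x ≡ y) →
  (xs : List X) → Unique xs → (∀ {x} → x ∈ xs → P (f x)) →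
  (∀ W → P W → ∃ λ x → x ∈ xs × (∀ v → W v ≡ f x v)) → N ≡ length xs
count≡length {N = N} F (enum , enum∈ , enum-injective , enum-complete) f f-injective xs unique sound complete =
  ℕₚ.≤-antisym (Finₚ.injective⇒≤ to-injective) (Finₚ.injective⇒≤ from-injective)
  where
  name : ∀ i → ∃ λ x → x ∈ xs × (∀ v → enum i v ≡ f x v)
  name i = complete (enum i) (enum∈ i)

  to : Fin N → Fin (length xs)
  to i = index (proj₁ (proj₂ (name i)))

  to-injective : ∀ {i j} → to i ≡ to j → i ≡ j
  to-injective {i} {j} e = enum-injective i j λ v → trans (proj₂ (proj₂ (name i)) v)
    (trans (cong (λ x → f x v) same) (sym (proj₂ (proj₂ (name j)) v)))
    where
    same : proj₁ (name i) ≡ proj₁ (name j)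
    same = trans (Anyₚ.lookup-index (proj₁ (proj₂ (name i))))
      (trans (cong (List.lookup xs) e) (sym (Anyₚ.lookup-index (proj₁ (proj₂ (name j))))))

  found : ∀ k → ∃ λ i → ∀ v → f (List.lookup xs k) v ≡ enum i v
  found k = enum-complete (f (List.lookup xs k)) (sound (∈ₚ.∈-lookup k))

  from : Fin (length xs) → Fin N
  from k = proj₁ (found k)

  from-injective : ∀ {k l} → from k ≡ from l → k ≡ l
  from-injective {k} {l} e = unique-lookup unique k l (f-injective _ _ λ v →
    trans (proj₂ (found k) v) (trans (cong (λ i → enum i v) e) (sym (proj₂ (found l) v))))

module Counting {q : ℕ} (F : FiniteField q) {ℓ m : ℕ} (1≤ℓ : 1 ≤ ℓ)
  (α : Fin ℓ → ℕ) (incr : StrictIncr α) (bounds : ∀ i → 1 ≤ α i × α i ≤ m)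
  {u : ℕ} (p : Fin u → ℕ) (blocks : Blocks ℓ α u p) where

  open Subspaces F
  open Blocked α incr (proj₁ ∘ bounds) p blocks
  open BlockEnds (αAt α ∘ p) p (αAt α ℓ) ℓ using (Ends; ends?; ok; checkpoints)
  open Enumeration q ok
  open DimensionWalk q two≤q ℓ ok using (H; H≡boxSum; blockProduct)

  1≤p : ∀ k → 1 ≤ p k
  1≤p k = proj₁ (proj₁ (proj₂ blocks) k)

  p<ℓ : ∀ k → p k < ℓ
  p<ℓ k = proj₂ (proj₁ (proj₂ blocks) k)

  p≤ℓ : ∀ k → p k ≤ ℓ
  p≤ℓ k = ℕₚ.<⇒≤ (p<ℓ k)

  0<αAt-p : ∀ k → 0 < αAt α (p k)
  0<αAt-p k = αAt-< {0} (1≤p k) (p≤ℓ k)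

  0<αAt-ℓ : 0 < αAt α ℓ
  0<αAt-ℓ = αAt-< {0} 1≤ℓ ℕₚ.≤-refl

  αAt≤m : ∀ j → 1 ≤ j → j ≤ ℓ → αAt α j ≤ m
  αAt≤m (suc j) _ j<ℓ = subst (_≤ m) (trans (sym (αAt-suc (Fin.fromℕ< j<ℓ))) (cong (αAt α ∘ suc) (Finₚ.toℕ-fromℕ< j<ℓ)))
    (proj₂ (bounds (Fin.fromℕ< j<ℓ)))

  -- All block ends are positive, so nothing is demanded at 0.
  ok-start : ok 0 0 ≡ true
  ok-start = ⌊⌋-true (ends? 0 0)
    ((λ k e → ⊥-elim (ℕₚ.<-irrefl (sym e) (0<αAt-p k))) , λ e → ⊥-elim (ℕₚ.<-irrefl (sym e) 0<αAt-ℓ))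

  cells : List (Echelon q m ℓ)
  cells = echelons m ℓ 0 0

  ∈-cells : ∀ (x : Echelon q m ℓ) → (∀ i → suc (toℕ i) ≤ jumps x (α i)) → x ∈ cells
  ∈-cells x meets = ∈-echelons x 0 0 λ j _ → ⌊⌋-true (ends? j (jumps x j))
    ( (λ k e → subst (λ a → p k ≤ jumps x a) e (meets⇒meets-at x meets (p k) (1≤p k) (p≤ℓ k)))
    , (λ e → subst (λ a → ℓ ≤ jumps x a) e (meets⇒meets-at x meets ℓ 1≤ℓ ℕₚ.≤-refl)))

  cells-meet : ∀ {x} → x ∈ cells → ∀ i → suc (toℕ i) ≤ jumps x (α i)
  cells-meet {x} x∈ = meets-ends⇒meets x
    (λ k → proj₁ (ends (αAt α (p k)) (αAt≤m (p k) (1≤p k) (p≤ℓ k))) k refl)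
    (proj₂ (ends (αAt α ℓ) (αAt≤m ℓ 1≤ℓ ℕₚ.≤-refl)) refl)
    where
    ends : ∀ j → j ≤ m → Ends (αAt α ∘ p) p j (jumps x j)
    ends j j≤m = true-⌊⌋ (ends? j (jumps x j)) (echelons-admissible x 0 0 x∈ j j≤m)

  -- At a = s = 0 the conversion factor between the two weightings is q^0 = 1.
  length-cells≡H : + length cells ≡ H m 0 0
  length-cells≡H = trans (cong +_ (sym (ℕₚ.*-identityˡ (length cells)))) (length-echelons two≤q ℓ m ℓ 0 0 z≤n refl)

  H≡boxSum-p : H m 0 0 ≡ boxSum p (αAt α ∘ p) (λ σ → blockProduct 0 0 (αAt α ∘ p) σ (αAt α ℓ))
  H≡boxSum-p = H≡boxSum m 0 0 (αAt α ∘ p) p refl z≤n ok-start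
    (checkpoints 0 (αAt α ∘ p) p (λ i j i<j → αAt-< (proj₁ blocks i j i<j) (p≤ℓ j)) 0<αAt-p (λ k → αAt-< (p<ℓ k) ℕₚ.≤-refl)
      0<αAt-ℓ (αAt≤m ℓ 1≤ℓ ℕₚ.≤-refl) (≤αAt ℓ ℕₚ.≤-refl) (λ j d _ → ⌊⌋-true (ends? j d)) (λ j d _ → true-⌊⌋ (ends? j d)))

  boxSum≡schubertLength : boxSum p (αAt α ∘ p) (λ σ → blockProduct 0 0 (αAt α ∘ p) σ (αAt α ℓ)) ≡ schubertLength q ℓ α u p
  boxSum≡schubertLength = boxSum-cong p (αAt α ∘ p) (λ σ → prodFin-cong {suc u} (λ i → lam-cong q
    (at (toℕ i)) (at (suc (toℕ i))) (sym (extend≡seq σ ℓ (toℕ i))) (sym (extend≡seq σ ℓ (suc (toℕ i))))))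
    where
    at : ∀ k → seq 0 (αAt α ∘ p) (αAt α ℓ) k ≡ αAt α (extend p ℓ k)
    at k = sym (trans (cong (αAt α) (extend≡seq p ℓ k)) (seq-map (αAt α) 0 p ℓ k))

  count≡length-cells : ∀ {N} → LinAlg.HasCount F m (LinAlg.InSchubert F m ℓ α) N → N ≡ length cells
  count≡length-cells count = count≡length F count mem mem-injective cells (echelons-unique m ℓ 0 0)
    (λ {x} x∈ → echelon⇒schubert α x (cells-meet x∈))
    (λ W W∈ → let x , W≈x , meets = schubert⇒echelon α W∈ in x , ∈-cells x meets , W≈x)

theorem2p4 : (q : ℕ) (F : FiniteField q) (ℓ m : ℕ) → 1 ≤ ℓ → ℓ ≤ m →
    (α : Fin ℓ → ℕ) → StrictIncr α → (∀ i → 1 ≤ α i × α i ≤ m) →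
    (u : ℕ) (p : Fin u → ℕ) → Blocks ℓ α u p →
    (N : ℕ) → LinAlg.HasCount F m (LinAlg.InSchubert F m ℓ α) N →
    + N ≡ schubertLength q ℓ α u p
theorem2p4 q F ℓ m 1≤ℓ ℓ≤m α incr bounds u p blocks N count =
  trans (cong +_ (count≡length-cells count)) (trans length-cells≡H (trans H≡boxSum-p boxSum≡schubertLength))
  where open Counting F 1≤ℓ α incr bounds p blocks
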